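{- Let $s \geq 2$ be an integer, $n = 2^s$, and let $L_s$ be the latin square of order $n$ (rows, columns and symbols indexed by $\{0,1,\ldots,n-1\}$) whose cell $(x,y)$ contains $x \oplus y$, where $\oplus$ denotes bitwise exclusive-or of binary representations. Let $k,k' \in \{0,\ldots,n-1\}$ satisfy $|k-k'| < 3$ and $j \leq k < k' < j+4$ for some integer $j \equiv 0 \pmod 4$. Let $\alpha_{k,k'}$ be the permutation of $\{0,\ldots,n-1\}$ that swaps $k$ and $k'$ and fixes every other element, and let $\alpha_{k,k'} L_s = \{(\alpha_{k,k'}(r), c; e) \mid (r,c;e) \in L_s\}$ (the latin square obtained from $L_s$ by interchanging rows $k$ and $k'$). Then $\mathrm{gcs}(\alpha_{k,k'} L_s)$ is 2-critical, has strong completion to $\alpha_{k,k'} L_s$, and completes top down to $\alpha_{k,k'} L_s$.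
   Context: A latin square of order $n$ is an $n\times n$ array with rows, columns and symbols indexed by $N_n=\{0,\ldots,n-1\}$ in which each symbol occurs exactly once in each row and each column; a partial latin square is such an array with some cells empty and each symbol at most once per row and column. Both are identified with sets of triples $(r,c;e)$ meaning symbol $e$ is in cell $(r,c)$. A partial latin square $P$ contained in a latin square $L$ is uniquely completable (to $L$) if $L$ is the only latin square of order $n$ containing $P$. A critical set of $L$ is a uniquely completable $C \subseteq L$ such that no proper subset of $C$ is uniquely completable. An intercalate is a $2\times 2$ subsquare, i.e. a set $\{(r_1,c_1;a),(r_1,c_2;b),(r_2,c_1;b),(r_2,c_2;a)\}\subseteq L$ with $r_1\ne r_2$, $c_1\ne c_2$. A critical set $C$ is 2-critical if for every $x \in C$ there is an intercalate $I \subseteq L$ with $C \cap I = \{x\}$. The greedy critical set $\mathrm{gcs}(L)$ of a latin square $L$ of order $n$ is defined as follows: start with $P = L$ and process the cells in the order $(n-1,n-1),(n-1,n-2),\ldots,(n-1,0),(n-2,n-1),\ldots,(n-2,0),\ldots,(0,n-1),\ldots,(0,0)$ (rows from bottom to top, each row from right to left); at each cell $(x,y)$, with $(x,y;z)\in P$, replace $P$ by $P\setminus\{(x,y;z)\}$ if that set is still uniquely completable (to $L$), otherwise keep $P$. The final $P$ is $\mathrm{gcs}(L)$. For a partial latin square $P$ and an empty cell $(r,c)$ of $P$, the set of alternatives at $(r,c)$ is $N_n \setminus (\mathcal{R}^r_P \cup \mathcal{C}^c_P)$, where $\mathcal{R}^r_P$ and $\mathcal{C}^c_P$ are the sets of symbols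 occurring in row $r$ and in column $c$ of $P$. $P$ has strong completion to $L$ if it is uniquely completable to $L$ and there is a chain $P = P_0 \subset P_1 \subset \cdots \subset P_m = L$, $m = n^2 - |P|$, where each $P_{t+1}$ is obtained from $P_t$ by filling an empty cell whose set of alternatives (with respect to $P_t$) has exactly one element, with that element. $P$ completes top down to $L$ if, for each $i$, once rows $0,\ldots,i-1$ have been filled in as in $L$, the entries of row $i$ have a unique extension (are uniquely determined), so that all rows can be filled successively from top to bottom. -}

module Defs where

open import Data.Nat using (ℕ; zero; suc; _+_; _*_; _^_; _≤_; _<_; s≤s; z≤n; _<?_)
open import Data.Nat.Properties using (≤-trans; +-mono-≤; *-monoʳ-≤; ≤-refl; +-suc; m≤n⇒m≤1+n)
open import Data.Nat.DivMod using (_%_; _/_; m%n<n)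
open import Data.Fin using (Fin; toℕ; fromℕ<; _≟_)
open import Data.Maybe using (Maybe; just; nothing)
open import Data.Product using (Σ; _×_; _,_)
open import Data.Sum using (_⊎_)
open import Data.List using (List; []; _∷_; map; concatMap; allFin; reverse)
open import Relation.Nullary using (¬_; yes; no)
open import Relation.Binary.PropositionalEquality using (_≡_; _≢_; refl; cong)

-- A (full) square of order n: cell (r,c) ↦ symbol.  The set of triples
-- (r,c;e) with L r c ≡ e.
Square : ℕ → Set
Square n = Fin n → Fin n → Fin n

Partial : ℕ → Set
Partial n = Fin n → Fin n → Maybe (Fin n)

IsLatin : ∀ {n} → Square n → Set
IsLatin {n} L =
  (∀ (r e : Fin n) → Σ (Fin n) λ c → L r c ≡ e × (∀ c' → L r c' ≡ e → c' ≡ c)) ×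
  (∀ (c e : Fin n) → Σ (Fin n) λ r → L r c ≡ e × (∀ r' → L r' c ≡ e → r' ≡ r))

IsPartialLatin : ∀ {n} → Partial n → Set
IsPartialLatin {n} P =
  (∀ (r c c' e : Fin n) → P r c ≡ just e → P r c' ≡ just e → c ≡ c') ×
  (∀ (c r r' e : Fin n) → P r c ≡ just e → P r' c ≡ just e → r ≡ r')

full : ∀ {n} → Square n → Partial n
full L r c = just (L r c)

_⊆L_ : ∀ {n} → Partial n → Square n → Set
_⊆L_ {n} P L = ∀ (r c e : Fin n) → P r c ≡ just e → L r c ≡ e

_⊆P_ : ∀ {n} → Partial n → Partial n → Set
_⊆P_ {n} Q P = ∀ (r c e : Fin n) → Q r c ≡ just e → P r c ≡ just e

UniquelyCompletable : ∀ {n} → Partial n → Square n → Set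
UniquelyCompletable {n} P L =
  P ⊆L L × (∀ (L' : Square n) → IsLatin L' → P ⊆L L' → ∀ r c → L' r c ≡ L r c)

IsCritical : ∀ {n} → Partial n → Square n → Set
IsCritical {n} C L =
  UniquelyCompletable C L ×
  (∀ (Q : Partial n) → Q ⊆P C → ¬ (C ⊆P Q) → ¬ UniquelyCompletable Q L)

record Intercalate {n} (L : Square n) : Set where
  field
    r₁ r₂ c₁ c₂ : Fin n
    r₁≢r₂ : r₁ ≢ r₂
    c₁≢c₂ : c₁ ≢ c₂
    diag  : L r₁ c₁ ≡ L r₂ c₂
    anti  : L r₁ c₂ ≡ L r₂ c₁

InCells : ∀ {n} {L : Square n} → Intercalate L → Fin n → Fin n → Set
InCells I a b = (a ≡ Intercalate.r₁ I ⊎ a ≡ Intercalate.r₂ I) ×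
                (b ≡ Intercalate.c₁ I ⊎ b ≡ Intercalate.c₂ I)

IsTwoCritical : ∀ {n} → Partial n → Square n → Set
IsTwoCritical {n} C L =
  IsCritical C L ×
  (∀ (r c e : Fin n) → C r c ≡ just e →
     Σ (Intercalate L) λ I →
       InCells I r c ×
       (∀ (a b e' : Fin n) → InCells I a b → C a b ≡ just e' → (a ≡ r × b ≡ c)))

remove : ∀ {n} → Partial n → Fin n → Fin n → Partial n
remove P x y r c with r ≟ x | c ≟ y
... | yes _ | yes _ = nothing
... | _     | _     = P r c

greedyOrder : ∀ n → List (Fin n × Fin n)
greedyOrder n = reverse (concatMap (λ r → map (λ c → (r , c)) (allFin n)) (allFin n))

data GreedyRun {n} (L : Square n) : List (Fin n × Fin n) → Partial n → Partial n → Set where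
  done : ∀ {P} → GreedyRun L [] P P
  drop : ∀ {x y cs P Q} → UniquelyCompletable (remove P x y) L →
         GreedyRun L cs (remove P x y) Q → GreedyRun L ((x , y) ∷ cs) P Q
  keep : ∀ {x y cs P Q} → ¬ UniquelyCompletable (remove P x y) L →
         GreedyRun L cs P Q → GreedyRun L ((x , y) ∷ cs) P Q

IsGcs : ∀ {n} → Square n → Partial n → Set
IsGcs {n} L G = GreedyRun L (greedyOrder n) (full L) G

InRow : ∀ {n} → Partial n → Fin n → Fin n → Set
InRow {n} P r e = Σ (Fin n) λ c → P r c ≡ just e

InCol : ∀ {n} → Partial n → Fin n → Fin n → Set
InCol {n} P c e = Σ (Fin n) λ r → P r c ≡ just e

Alternative : ∀ {n} → Partial n → Fin n → Fin n → Fin n → Set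
Alternative P r c e = ¬ InRow P r e × ¬ InCol P c e

UniqueAlternative : ∀ {n} → Partial n → Fin n → Fin n → Fin n → Set
UniqueAlternative {n} P r c e =
  Alternative P r c e × (∀ (e' : Fin n) → Alternative P r c e' → e' ≡ e)

fill : ∀ {n} → Partial n → Fin n → Fin n → Fin n → Partial n
fill P x y e r c with r ≟ x | c ≟ y
... | yes _ | yes _ = just e
... | _     | _     = P r c

data ForcedChain {n} (L : Square n) : Partial n → Set where
  finished : ∀ {P} → (∀ r c → P r c ≡ just (L r c)) → ForcedChain L P
  step     : ∀ {P} (r c e : Fin n) → P r c ≡ nothing → UniqueAlternative P r c e →
             ForcedChain L (fill P r c e) → ForcedChain L P

HasStrongCompletion : ∀ {n} → Partial n → Square n → Set
HasStrongCompletion P L = UniquelyCompletable P L × ForcedChain L P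

fillRowsAbove : ∀ {n} → Square n → Partial n → ℕ → Partial n
fillRowsAbove L P i r c with toℕ r <? i
... | yes _ = just (L r c)
... | no  _ = P r c

RowFilling : ∀ {n} → Partial n → Fin n → (Fin n → Fin n) → Set
RowFilling {n} Q i f =
  (∀ (e : Fin n) → Σ (Fin n) λ c → f c ≡ e × (∀ c' → f c' ≡ e → c' ≡ c)) ×
  (∀ (c e : Fin n) → Q i c ≡ just e → f c ≡ e) ×
  (∀ (r c e : Fin n) → r ≢ i → Q r c ≡ just e → f c ≢ e)

CompletesTopDown : ∀ {n} → Partial n → Square n → Set
CompletesTopDown {n} P L =
  ∀ (i : Fin n) (f : Fin n → Fin n) → RowFilling (fillRowsAbove L P (toℕ i)) i f →
    ∀ c → f c ≡ L i c

xorBits : ℕ → ℕ → ℕ → ℕ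
xorBits zero    a b = 0
xorBits (suc s) a b = ((a % 2) + (b % 2)) % 2 + 2 * xorBits s (a / 2) (b / 2)

xorBits<2^s : ∀ s a b → xorBits s a b < 2 ^ s
xorBits<2^s zero a b = s≤s z≤n
xorBits<2^s (suc s) a b =
  ≤-trans (+-mono-≤ (m%n<n ((a % 2) + (b % 2)) 2) (≤-refl {2 * xorBits s (a / 2) (b / 2)}))
          (≤-trans (≤-refl {2 + 2 * xorBits s (a / 2) (b / 2)})
                   (lem (xorBits s (a / 2) (b / 2)) (xorBits<2^s s (a / 2) (b / 2))))
  where
  lem : ∀ x → x < 2 ^ s → 2 + 2 * x ≤ 2 * 2 ^ s
  lem x x<  = ≤-trans (≤-refl {2 + 2 * x}) (help x<)
    where
    help : suc x ≤ 2 ^ s → 2 + 2 * x ≤ 2 * 2 ^ s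
    help p with *-monoʳ-≤ 2 p
    ... | q rewrite +-suc x (x + 0) = q

Ls : ∀ s → Square (2 ^ s)
Ls s x y = fromℕ< (xorBits<2^s s (toℕ x) (toℕ y))

swapFin : ∀ {n} → Fin n → Fin n → Fin n → Fin n
swapFin k k' r with r ≟ k | r ≟ k'
... | yes _ | _     = k'
... | no _  | yes _ = k
... | no _  | no _  = r

-- α L = {(α r, c; e) | (r,c;e) ∈ L}; since α is an involution,
-- cell (r,c) of α L holds L (α r) c.
permuteRows : ∀ {n} → (Fin n → Fin n) → Square n → Square n
permuteRows α L r c = L (α r) c

{-# OPTIONS --safe #-}
module Submission where

-- Every row of L = α L_s is x ↦ a ⊕ x for a label a, so an intercalate through (r , c) is a choice of a second
-- row r': its second column c' satisfies c ⊕ c' = label r ⊕ label r'.  The cells removed by the greedy algorithm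
-- (the holes) have an explicit description, and two facts about it suffice.
--  * Every cell which is not a hole is the top left corner of an intercalate whose other three cells are holes;
--    they are processed earlier, so switching the intercalate shows that the cell has to be kept.
--  * The holes of a row can be ranked so that, when rows above and holes of smaller rank are filled, each
--    symbol missing from the row except the right one already occurs in the column.  This gives the strong and
--    the top down completion, hence unique completability.
-- Write a row as (ρ , u) and a column as (σ , v), where ρ, σ are the two lowest bits, and let q be the upper part
-- of the swapped rows.  Whether a cell is a hole depends only on ρ, σ and on a coarse relation (the kind)
-- between u, v and q.  So each of the two facts splits into a bitwise statement on u, v, q and a finite check on
-- the two lowest bits.

open import Defs
open import Data.Nat using (ℕ; zero; suc; _+_; _*_; _^_; _≡ᵇ_; _≤_; _<_; _∸_; z≤n; s≤s; _≤?_; _<?_)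
open import Data.Nat.Divisibility using (_∣_; divides; n∣m*n)
open import Data.Nat.DivMod using (_%_; _/_; m≡m%n+[m/n]*n; m%n<n; m<n*o⇒m/o<n; [m+kn]%n≡m%n; m*n/n≡m; +-distrib-/-∣ʳ)
open import Data.Nat.Induction using (<-wellFounded)
open import Data.Nat.Properties using (≤-antisym; ≤-trans; <⇒≢; ≤⇒≯; <⇒≱; ≰⇒>; ≮⇒≥; ≤∧≢⇒<; <-irrefl; <-asym; <-cmp; m≤n⇒m<n∨m≡n; m<1+n⇒m≤n; +-assoc; +-comm; +-cancelʳ-≡; +-cancelˡ-≤; +-cancelʳ-<; m≤m+n; m≤n+m; +-mono-≤; +-monoˡ-≤; +-mono-<-≤; +-mono-≤-<; +-monoˡ-<; +-monoʳ-<; *-suc; *-comm; *-distribˡ-+; *-assoc; *-monoʳ-≤; *-cancelˡ-<; [m+n]∸[m+o]≡n∸o; module ≤-Reasoning)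
open import Data.Bool using (Bool; true; false; not; _∧_; _∨_; _xor_; T; if_then_else_)
import Data.Bool.Properties as Bool
open import Data.Bool.Properties using (T?)
open import Data.Empty using (⊥)
open import Data.Fin using (Fin; toℕ; fromℕ<; _≟_)
open import Data.Fin.Properties using (any?; toℕ-fromℕ<; toℕ-injective; toℕ<n)
open import Data.List using (List; []; _∷_; map; reverse; allFin; length; filter; cartesianProduct)
open import Data.List.Properties using (unfold-reverse; filter-notAll)
open import Data.List.Membership.Propositional using (_∈_; lose)
open import Data.List.Membership.Propositional.Properties using (∈-allFin; ∈-cartesianProduct⁺; ∈-filter⁺; ∈-concatMap⁺; ∈-map⁺)
import Data.List.Relation.Unary.All as All
import Data.List.Relation.Unary.All.Properties as All
open import Data.List.Relation.Unary.All using ([]; _∷_)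
import Data.List.Relation.Unary.AllPairs.Properties as AllPairs
open import Data.List.Relation.Unary.AllPairs using (AllPairs; []; _∷_)
import Data.List.Relation.Unary.Any as Any
import Data.List.Relation.Unary.Any.Properties as Any
open import Data.List.Relation.Unary.Any using (here; there)
open import Data.Maybe using (just; nothing)
open import Data.Maybe.Properties using (just-injective)
open import Data.Product using (Σ; ∃; _×_; _,_; proj₁; proj₂)
import Data.Product.Properties as Product
open import Data.Sum using (_⊎_; inj₁; inj₂; [_,_]′)
open import Data.Unit using (⊤; tt)
open import Data.Vec using (Vec; []; _∷_; zipWith; head; tail)
import Data.Vec.Properties as Vec
open import Function using (_∘_; flip)
open import Induction.WellFounded using (Acc; acc)
open import Relation.Binary.Definitions using (tri<; tri≈; tri>)
open import Relation.Binary.PropositionalEquality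
open import Relation.Nullary using (¬_; Dec; yes; no; contradiction)
open import Relation.Nullary.Decidable using (_×-dec_; _⊎-dec_; _→-dec_; ¬?; map′; True; toWitness)
open import Relation.Unary using (Decidable)

private variable
  m n : ℕ

-- Transpositions and latin squares with two rows interchanged

swapFin-left : (a b : Fin n) → swapFin a b a ≡ b
swapFin-left a b with a ≟ a | a ≟ b
... | yes _  | _ = refl
... | no a≢a | _ = contradiction refl a≢a

swapFin-right : (a b : Fin n) → swapFin a b b ≡ a
swapFin-right a b with b ≟ a | b ≟ b
... | yes b≡a | _      = b≡a
... | no _    | yes _  = refl
... | no _    | no b≢b = contradiction refl b≢b

swapFin-fixed : (a b : Fin n) {x : Fin n} → ¬ (x ≡ a ⊎ x ≡ b) → swapFin a b x ≡ x
swapFin-fixed a b {x} x∉ with x ≟ a | x ≟ b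
... | yes x≡a | _       = contradiction (inj₁ x≡a) x∉
... | no _    | yes x≡b = contradiction (inj₂ x≡b) x∉
... | no _    | no _    = refl

swapFin-involutive : (a b x : Fin n) → swapFin a b (swapFin a b x) ≡ x
swapFin-involutive a b x with (x ≟ a) ⊎-dec (x ≟ b)
... | yes (inj₁ refl) = trans (cong (swapFin x b) (swapFin-left x b)) (swapFin-right x b)
... | yes (inj₂ refl) = trans (cong (swapFin a x) (swapFin-right a x)) (swapFin-left a x)
... | no x∉           = trans (cong (swapFin a b) (swapFin-fixed a b x∉)) (swapFin-fixed a b x∉)

UniquePreimages : (Fin n → Fin n) → Set
UniquePreimages {n} f = ∀ e → Σ (Fin n) λ x → f x ≡ e × (∀ y → f y ≡ e → y ≡ x)

uniquePreimages⇒injective : {f : Fin n → Fin n} → UniquePreimages f → ∀ {x y} → f x ≡ f y → x ≡ y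
uniquePreimages⇒injective u {x} {y} fx≡fy with u _
... | _ , _ , unique = trans (unique x fx≡fy) (sym (unique y refl))

uniquePreimages-swap : {f : Fin n → Fin n} (a b : Fin n) → UniquePreimages f → UniquePreimages (f ∘ swapFin a b)
uniquePreimages-swap {f = f} a b u e with u e
... | x , fx≡e , unique =
  swapFin a b x , trans (cong f (swapFin-involutive a b x)) fx≡e ,
  λ y fy≡e → trans (sym (swapFin-involutive a b y)) (cong (swapFin a b) (unique _ fy≡e))

uniquePreimages-≗ : {f g : Fin n → Fin n} → f ≗ g → UniquePreimages f → UniquePreimages g
uniquePreimages-≗ f≗g u e with u e
... | x , fx≡e , unique = x , trans (sym (f≗g x)) fx≡e , λ y gy≡e → unique y (trans (f≗g y) gy≡e)

permuteRows-swap-latin : {L : Square n} (a b : Fin n) → IsLatin L → IsLatin (permuteRows (swapFin a b) L)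
permuteRows-swap-latin a b (rows , cols) = rows ∘ swapFin a b , λ c → uniquePreimages-swap a b (cols c)

-- Switching an intercalate

module Switch {L : Square n} (latin : IsLatin L) (I : Intercalate L) where
  open Intercalate I

  inRows? : (r : Fin n) → Dec (r ≡ r₁ ⊎ r ≡ r₂)
  inRows? r = (r ≟ r₁) ⊎-dec (r ≟ r₂)

  inCols? : (c : Fin n) → Dec (c ≡ c₁ ⊎ c ≡ c₂)
  inCols? c = (c ≟ c₁) ⊎-dec (c ≟ c₂)

  -- Written as a column swap inside the two rows, which keeps every row latin at once; the
  -- intercalate equations are then needed only for the columns.
  switched : Square n
  switched r c with inRows? r
  ... | yes _ = L r (swapFin c₁ c₂ c)
  ... | no _  = L r c

  switched-row : ∀ r → UniquePreimages (switched r)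
  switched-row r with inRows? r
  ... | yes _ = uniquePreimages-swap c₁ c₂ (proj₁ latin r)
  ... | no _  = proj₁ latin r

  -- On the cells of an intercalate, swapping its columns and swapping its rows give the same symbols.
  switched-inCol : ∀ {c} → c ≡ c₁ ⊎ c ≡ c₂ → ∀ r → L (swapFin r₁ r₂ r) c ≡ switched r c
  switched-inCol c∈ r with inRows? r
  switched-inCol (inj₁ refl) r | yes (inj₁ refl) =
    trans (cong (λ x → L x c₁) (swapFin-left r₁ r₂)) (trans (sym anti) (cong (L r₁) (sym (swapFin-left c₁ c₂))))
  switched-inCol (inj₁ refl) r | yes (inj₂ refl) =
    trans (cong (λ x → L x c₁) (swapFin-right r₁ r₂)) (trans diag (cong (L r₂) (sym (swapFin-left c₁ c₂))))
  switched-inCol (inj₂ refl) r | yes (inj₁ refl) =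
    trans (cong (λ x → L x c₂) (swapFin-left r₁ r₂)) (trans (sym diag) (cong (L r₁) (sym (swapFin-right c₁ c₂))))
  switched-inCol (inj₂ refl) r | yes (inj₂ refl) =
    trans (cong (λ x → L x c₂) (swapFin-right r₁ r₂)) (trans anti (cong (L r₂) (sym (swapFin-right c₁ c₂))))
  switched-inCol _ r | no r∉ = cong (λ x → L x _) (swapFin-fixed r₁ r₂ r∉)

  switched-outCol : ∀ {c} → ¬ (c ≡ c₁ ⊎ c ≡ c₂) → ∀ r → L r c ≡ switched r c
  switched-outCol c∉ r with inRows? r
  ... | yes _ = cong (L r) (sym (swapFin-fixed c₁ c₂ c∉))
  ... | no _  = refl

  switched-col : ∀ c → UniquePreimages (λ r → switched r c)
  switched-col c with inCols? c
  ... | yes c∈ = uniquePreimages-≗ (switched-inCol c∈) (uniquePreimages-swap r₁ r₂ (proj₂ latin c))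
  ... | no c∉  = uniquePreimages-≗ (switched-outCol c∉) (proj₂ latin c)

  switched-⊆ : {Q : Partial n} → Q ⊆L L → (∀ a b → InCells I a b → Q a b ≡ nothing) → Q ⊆L switched
  switched-⊆ Q⊆L empty r c e Q≡ with inRows? r | inCols? c
  ... | no _   | _      = Q⊆L r c e Q≡
  ... | yes _  | no c∉  = trans (cong (L r) (swapFin-fixed c₁ c₂ c∉)) (Q⊆L r c e Q≡)
  ... | yes r∈ | yes c∈ with () ← trans (sym Q≡) (empty r c (r∈ , c∈))

  -- The switched square is another latin square containing `Q`. Agreement with `L` at `(r₁ , c₁)`
  -- would repeat a symbol in row `r₁` of `L`.
  ¬uniquelyCompletable : {Q : Partial n} → (∀ a b → InCells I a b → Q a b ≡ nothing) → ¬ UniquelyCompletable Q L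
  ¬uniquelyCompletable empty (Q⊆L , unique) = c₁≢c₂ (sym (uniquePreimages⇒injective (proj₁ latin r₁) (begin
    L r₁ c₂                      ≡⟨ anti ⟩
    L r₂ c₁                      ≡⟨ cong (λ x → L x c₁) (swapFin-left r₁ r₂) ⟨
    L (swapFin r₁ r₂ r₁) c₁      ≡⟨ switched-inCol (inj₁ refl) r₁ ⟩
    switched r₁ c₁               ≡⟨ unique switched (switched-row , switched-col) (switched-⊆ Q⊆L empty) r₁ c₁ ⟩
    L r₁ c₁                      ∎)))
    where open ≡-Reasoning

-- Reading order and greedy order of the cells

module _ {a r} {A : Set a} {R : A → A → Set r} where
  reverse⁺ : ∀ {xs} → AllPairs R xs → AllPairs (flip R) (reverse xs)
  reverse⁺ []                          = []
  reverse⁺ {x ∷ xs} (Rx ∷ Rxs) rewrite unfold-reverse x xs =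
    AllPairs.++⁺ (reverse⁺ Rxs) ([] ∷ [])
      (All.tabulate λ y∈ → All.lookup Rx (Any.reverse⁻ y∈) ∷ [])

_≺_ : Fin n × Fin n → Fin n × Fin n → Set
(r , c) ≺ (r' , c') = toℕ r < toℕ r' ⊎ (r ≡ r' × toℕ c < toℕ c')

≺-irrefl : {x : Fin n × Fin n} → ¬ (x ≺ x)
≺-irrefl (inj₁ r<r)       = <-irrefl refl r<r
≺-irrefl (inj₂ (_ , c<c)) = <-irrefl refl c<c

≺-asym : {x y : Fin n × Fin n} → x ≺ y → ¬ (y ≺ x)
≺-asym (inj₁ p)          (inj₁ q)          = <-asym p q
≺-asym (inj₁ p)          (inj₂ (refl , _)) = <-irrefl refl p
≺-asym (inj₂ (refl , _)) (inj₁ q)          = <-irrefl refl q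
≺-asym (inj₂ (_ , p))    (inj₂ (_ , q))    = <-asym p q

greedyOrder-sorted : ∀ n → AllPairs (flip _≺_) (greedyOrder n)
greedyOrder-sorted n = reverse⁺ (AllPairs.concat⁺
  (All.map⁺ (All.tabulate λ _ → AllPairs.map⁺ (AllPairs.tabulate⁺-< λ c<c' → inj₂ (refl , c<c'))))
  (AllPairs.map⁺ (AllPairs.tabulate⁺-< λ r<r' →
    All.map⁺ (All.tabulate λ _ → All.map⁺ (All.tabulate λ _ → inj₁ r<r')))))

∈-greedyOrder : (x : Fin n × Fin n) → x ∈ greedyOrder n
∈-greedyOrder (r , c) = Any.reverse⁺
  (∈-concatMap⁺ (λ r → map (r ,_) (allFin _)) (Any.map (λ { refl → ∈-map⁺ (r ,_) (∈-allFin c) }) (∈-allFin r)))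

-- Minimal elements; removing and filling single cells

minimise : ∀ {p} {P : Fin n → Set p} (P? : Decidable P) (f : Fin n → ℕ) → ∃ P →
  ∃ λ x → P x × (∀ y → P y → f x ≤ f y)
minimise {n} {P = P} P? f (x , px) = go x px (<-wellFounded (f x))
  where
  go : ∀ x → P x → Acc _<_ (f x) → ∃ λ x → P x × (∀ y → P y → f x ≤ f y)
  go x px (acc rs) with any? (λ y → P? y ×-dec (f y <? f x))
  ... | yes (y , py , fy<fx) = go y py (rs fy<fx)
  ... | no none              = x , px , λ y py → ≮⇒≥ λ fy<fx → none (y , py , fy<fx)

remove-self : (P : Partial n) (x y : Fin n) → remove P x y x y ≡ nothing
remove-self P x y with x ≟ x | y ≟ y
... | yes _  | yes _  = refl
... | no x≢x | _      = contradiction refl x≢x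
... | yes _  | no y≢y = contradiction refl y≢y

remove-nothing : (P : Partial n) (x y : Fin n) {a b : Fin n} → P a b ≡ nothing → remove P x y a b ≡ nothing
remove-nothing P x y {a} {b} eq with a ≟ x | b ≟ y
... | yes _ | yes _ = refl
... | yes _ | no _  = eq
... | no _  | _     = eq

fill-self : (P : Partial n) (x y e : Fin n) → fill P x y e x y ≡ just e
fill-self P x y e with x ≟ x | y ≟ y
... | yes _  | yes _  = refl
... | no x≢x | _      = contradiction refl x≢x
... | yes _  | no y≢y = contradiction refl y≢y

fill-other : (P : Partial n) (x y e : Fin n) {a b : Fin n} → ¬ (a ≡ x × b ≡ y) → fill P x y e a b ≡ P a b
fill-other P x y e {a} {b} ≢ with a ≟ x | b ≟ y
... | yes a≡x | yes b≡y = contradiction (a≡x , b≡y) ≢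
... | yes _   | no _    = refl
... | no _    | _       = refl

-- From a hole set to the greedy critical set and its properties

HasGoodGcs : Square n → Set
HasGoodGcs {n} L = Σ (Partial n) λ G →
  IsGcs L G × IsTwoCritical G L × HasStrongCompletion G L × CompletesTopDown G L

-- The two inequalities put the other three cells after `(r , c)` in reading order, so the greedy
-- algorithm has already removed them when it reaches `(r , c)`.
record CornerOf {n} (L : Square n) (hole : Fin n → Fin n → Bool) (r c : Fin n) : Set where
  field
    {r' c'}  : Fin n
    r<r'     : toℕ r < toℕ r'
    c<c'     : toℕ c < toℕ c'
    diagonal : L r c ≡ L r' c'
    antidiag : L r c' ≡ L r' c
    hole-rc' : hole r c' ≡ true
    hole-r'c : hole r' c ≡ true
    hole-r'c' : hole r' c' ≡ true

-- In `forced`, row `r'` keeps the symbol of `(r , c')` out of the hole `(r , c)`. Holes of smaller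
-- rank than `(r , c)` need no such row, as they are filled first.
module HoleSet {n} (L : Square n) (latin : IsLatin L) (hole : Fin n → Fin n → Bool) (rank : Fin n → Fin n → ℕ)
  (corner : ∀ r c → hole r c ≡ false → CornerOf L hole r c)
  (forced : ∀ r c c' → c ≢ c' → hole r c ≡ true → hole r c' ≡ true → rank r c ≤ rank r c' →
    Σ (Fin n) λ r' → L r' c ≡ L r c' × (toℕ r' < toℕ r ⊎ hole r' c ≡ false))
  where

  row-injective : ∀ {r c c'} → L r c ≡ L r c' → c ≡ c'
  row-injective {r} = uniquePreimages⇒injective (proj₁ latin r)

  col-injective : ∀ {r r' c} → L r c ≡ L r' c → r ≡ r'
  col-injective {c = c} = uniquePreimages⇒injective (proj₂ latin c)

  hole? : ∀ r c → hole r c ≡ true ⊎ hole r c ≡ false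
  hole? r c with hole r c
  ... | true  = inj₁ refl
  ... | false = inj₂ refl

  -- All partial squares met while the greedy algorithm removes cells, or while a completion fills
  -- them, are of this form, so the completion results are proved for all of them together.
  Between : Partial n → Set
  Between P = ∀ r c → P r c ≡ just (L r c) ⊎ (P r c ≡ nothing × hole r c ≡ true)

  module _ {P : Partial n} (between : Between P) where

    between-filled : ∀ {r c} → hole r c ≡ false → P r c ≡ just (L r c)
    between-filled {r} {c} filled with between r c
    ... | inj₁ P≡       = P≡
    ... | inj₂ (_ , is) with () ← trans (sym filled) is

    between-⊆ : P ⊆L L
    between-⊆ r c e P≡e with between r c
    ... | inj₁ P≡L     = just-injective (trans (sym P≡L) P≡e)
    ... | inj₂ (P≡ , _) with () ← trans (sym P≡e) P≡

    -- Induction on the rank of the hole. Let `c'` be the column where row `i` of `L` has the symbol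
    -- `f c`. If `c'` is filled or a hole of smaller rank, `f` takes this symbol at `c'` too, and
    -- injectivity gives `c ≡ c'`. If it is another hole of no smaller rank, `forced` finds the
    -- symbol elsewhere in column `c`.
    completesTopDown : CompletesTopDown P L
    completesTopDown i f (preimages , extends , avoids) c = go c (<-wellFounded _)
      where
      Q : Partial n
      Q = fillRowsAbove L P (toℕ i)

      f-filled : ∀ {c} → hole i c ≡ false → f c ≡ L i c
      f-filled {c} filled = extends c (L i c) Q≡
        where
        Q≡ : Q i c ≡ just (L i c)
        Q≡ with toℕ i <? toℕ i
        ... | yes _ = refl
        ... | no _  = between-filled filled

      Q-col : ∀ {r c} → toℕ r < toℕ i ⊎ hole r c ≡ false → Q r c ≡ just (L r c)
      Q-col {r} p with toℕ r <? toℕ i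
      Q-col p             | yes _  = refl
      Q-col (inj₁ r<i)    | no r≮i = contradiction r<i r≮i
      Q-col (inj₂ filled) | no _   = between-filled filled

      go : ∀ c → Acc _<_ (rank i c) → f c ≡ L i c
      go c (acc rs) with hole? i c | proj₁ latin i (f c)
      ... | inj₂ filled | _ = f-filled filled
      ... | inj₁ hole-c | c' , L≡f , _ with c ≟ c' | hole? i c'
      ... | yes refl | _           = sym L≡f
      ... | no _     | inj₂ filled =
        trans (sym L≡f) (cong (L i) (uniquePreimages⇒injective preimages (trans (f-filled filled) L≡f)))
      ... | no c≢c'  | inj₁ hole-c' with rank i c ≤? rank i c'
      ...   | no ≰  = trans (sym L≡f) (cong (L i) (uniquePreimages⇒injective preimages (trans (go c' (rs (≰⇒> ≰))) L≡f)))
      ...   | yes ≤ with r' , L≡ , above ← forced i c c' c≢c' hole-c hole-c' ≤ =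
        contradiction refl (avoids r' c (f c) r'≢i (trans (Q-col above) (cong just (trans L≡ L≡f))))
        where
        r'≢i : r' ≢ i
        r'≢i refl = c≢c' (row-injective L≡)

    -- Induction from the top row: once the rows above agree with `L`, row `r` of any completion is
    -- a row filling, and `completesTopDown` determines it.
    uniquelyCompletable : UniquelyCompletable P L
    uniquelyCompletable = between-⊆ , λ L' latin' P⊆L' r → rows latin' P⊆L' r (<-wellFounded _)
      where
      rows : ∀ {L'} → IsLatin L' → P ⊆L L' → ∀ r → Acc _<_ (toℕ r) → ∀ c → L' r c ≡ L r c
      rows {L'} latin' P⊆L' r (acc rs) = completesTopDown r (L' r) (proj₁ latin' r , extends , avoids)
        where
        extends : ∀ c e → fillRowsAbove L P (toℕ r) r c ≡ just e → L' r c ≡ e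
        extends c e Q≡e with toℕ r <? toℕ r
        ... | yes r<r = contradiction r<r (<-irrefl refl)
        ... | no _    = P⊆L' r c e Q≡e

        agrees : ∀ r' c e → fillRowsAbove L P (toℕ r) r' c ≡ just e → L' r' c ≡ e
        agrees r' c e Q≡e with toℕ r' <? toℕ r
        ... | yes r'<r = trans (rows latin' P⊆L' r' (rs r'<r) c) (just-injective Q≡e)
        ... | no _     = P⊆L' r' c e Q≡e

        avoids : ∀ r' c e → r' ≢ r → fillRowsAbove L P (toℕ r) r' c ≡ just e → L' r c ≢ e
        avoids r' c e r'≢r Q≡e L'≡e =
          r'≢r (uniquePreimages⇒injective (proj₂ latin' c) (trans (agrees r' c e Q≡e) (sym L'≡e)))

    -- Another symbol missing from row `r` belongs to an empty cell of no smaller rank, so `forced`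
    -- finds it in column `c`, either at a cell that is not a hole or in a row above, which is
    -- already full because `r` is the topmost row with an empty cell.
    uniqueAlternative : ∀ {r c} → P r c ≡ nothing →
      (∀ {r' c'} → P r' c' ≡ nothing → toℕ r ≤ toℕ r') →
      (∀ {c'} → P r c' ≡ nothing → rank r c ≤ rank r c') →
      UniqueAlternative P r c (L r c)
    uniqueAlternative {r} {c} empty top least = (¬inRow , ¬inCol) , unique
      where
      ¬inRow : ¬ InRow P r (L r c)
      ¬inRow (c' , P≡) with refl ← row-injective (between-⊆ r c' _ P≡) with () ← trans (sym empty) P≡

      ¬inCol : ¬ InCol P c (L r c)
      ¬inCol (r' , P≡) with refl ← col-injective (between-⊆ r' c _ P≡) with () ← trans (sym empty) P≡

      hole-at : ∀ {c'} → P r c' ≡ nothing → hole r c' ≡ true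
      hole-at {c'} P≡ with between r c'
      ... | inj₂ (_ , is) = is
      ... | inj₁ P≡L with () ← trans (sym P≡) P≡L

      occurs : ∀ {r'} → toℕ r' < toℕ r ⊎ hole r' c ≡ false → P r' c ≡ just (L r' c)
      occurs (inj₂ filled) = between-filled filled
      occurs {r'} (inj₁ r'<r) with between r' c
      ... | inj₁ P≡L      = P≡L
      ... | inj₂ (P≡ , _) = contradiction (top P≡) (<⇒≱ r'<r)

      unique : ∀ e → Alternative P r c e → e ≡ L r c
      unique e (∉row , ∉col) with proj₁ latin r e
      ... | c' , refl , _ with c ≟ c' | between r c'
      ... | yes refl | _             = refl
      ... | no _     | inj₁ P≡       = contradiction (c' , P≡) ∉row
      ... | no c≢c'  | inj₂ (P≡ , h) with forced r c c' c≢c' (hole-at empty) h (least P≡)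
      ... | r' , L≡ , above = contradiction (r' , trans (occurs above) (cong just L≡)) ∉col

  fill-between : ∀ {P} → Between P → ∀ x y → Between (fill P x y (L x y))
  fill-between {P} between x y r c with r ≟ x | c ≟ y
  ... | yes refl | yes refl = inj₁ refl
  ... | yes _    | no _     = between r c
  ... | no _     | _        = between r c

  isEmpty? : (P : Partial n) (r c : Fin n) → Dec (P r c ≡ nothing)
  isEmpty? P r c with P r c
  ... | nothing = yes refl
  ... | just _  = no λ ()

  -- Each step fills a hole of least rank in the topmost row that is not full. The list `cells`
  -- contains all empty cells and serves only as a termination measure.
  forcedChain : ∀ {P} → Between P → ForcedChain L P
  forcedChain between =
    go (cartesianProduct (allFin n) (allFin n)) (<-wellFounded _) between
       (λ _ → ∈-cartesianProduct⁺ (∈-allFin _) (∈-allFin _))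
    where
    go : ∀ {P} cells → Acc _<_ (length cells) → Between P →
      (∀ {r c} → P r c ≡ nothing → (r , c) ∈ cells) → ForcedChain L P
    go {P} cells (acc rs) between covers with any? (λ r → any? (isEmpty? P r))
    ... | no none = finished full'
      where
      full' : ∀ r c → P r c ≡ just (L r c)
      full' r c with between r c
      ... | inj₁ P≡       = P≡
      ... | inj₂ (P≡ , _) = contradiction (r , c , P≡) none
    ... | yes some
      with r , emptyRow , top ← minimise (λ r → any? (isEmpty? P r)) toℕ some
      with c , empty , least ← minimise (isEmpty? P r) (rank r) emptyRow =
      step r c (L r c) empty
        (uniqueAlternative between empty (λ P≡ → top _ (_ , P≡)) (λ P≡ → least _ P≡))
        (go (filter other? cells) (rs (filter-notAll other? cells (Any.map (λ eq ≢ → ≢ (sym eq)) (covers empty))))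
          (fill-between between r c) covers')
      where
      other? : Decidable (_≢ (r , c))
      other? x = ¬? (Product.≡-dec _≟_ _≟_ x (r , c))

      covers' : ∀ {a b} → fill P r c (L r c) a b ≡ nothing → (a , b) ∈ filter other? cells
      covers' {a} {b} P≡ with Product.≡-dec _≟_ _≟_ (a , b) (r , c)
      ... | yes refl with () ← trans (sym (fill-self P r c (L r c))) P≡
      ... | no ≢ = ∈-filter⁺ other?
        (covers (trans (sym (fill-other P r c (L r c) λ { (refl , refl) → ≢ refl })) P≡)) ≢

  strongCompletion : ∀ {P} → Between P → HasStrongCompletion P L
  strongCompletion between = uniquelyCompletable between , forcedChain between

  intercalate : ∀ {r c} → CornerOf L hole r c → Intercalate L
  intercalate {r} {c} k = record
    { r₁ = r ; r₂ = r' ; c₁ = c ; c₂ = c'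
    ; r₁≢r₂ = λ { refl → <-irrefl refl r<r' } ; c₁≢c₂ = λ { refl → <-irrefl refl c<c' }
    ; diag = diagonal ; anti = antidiag }
    where open CornerOf k

  intercalate-cells : ∀ {r c} (k : CornerOf L hole r c) {a b} → InCells (intercalate k) a b →
    (a ≡ r × b ≡ c) ⊎ (hole a b ≡ true × (r , c) ≺ (a , b))
  intercalate-cells k (inj₁ refl , inj₁ refl) = inj₁ (refl , refl)
  intercalate-cells k (inj₁ refl , inj₂ refl) = inj₂ (CornerOf.hole-rc' k , inj₂ (refl , CornerOf.c<c' k))
  intercalate-cells k (inj₂ refl , inj₁ refl) = inj₂ (CornerOf.hole-r'c k , inj₁ (CornerOf.r<r' k))
  intercalate-cells k (inj₂ refl , inj₂ refl) = inj₂ (CornerOf.hole-r'c' k , inj₁ (CornerOf.r<r' k))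

  Exact : Partial n → Set
  Exact P = Between P × (∀ {r c} → hole r c ≡ true → P r c ≡ nothing)

  remove-between : ∀ {P} → Between P → ∀ {x y} → hole x y ≡ true → Between (remove P x y)
  remove-between {P} between {x} {y} h r c with r ≟ x | c ≟ y
  ... | yes refl | yes refl = inj₂ (refl , h)
  ... | yes _    | no _     = between r c
  ... | no _     | _        = between r c

  -- The invariant is that each hole is either still to be processed or already removed. Dropping a
  -- hole preserves `Between`, hence unique completability.
  greedyRun : ∀ cs {P} → AllPairs (flip _≺_) cs → Between P →
    (∀ {a b} → hole a b ≡ true → (a , b) ∈ cs ⊎ P a b ≡ nothing) →
    Σ (Partial n) λ G → GreedyRun L cs P G × Exact G
  greedyRun [] {P} _ between pending = P , done , between , empty
    where
    empty : ∀ {r c} → hole r c ≡ true → P r c ≡ nothing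
    empty h with pending h
    ... | inj₂ P≡ = P≡
  greedyRun ((x , y) ∷ cs) {P} (before ∷ sorted) between pending with hole? x y
  ... | inj₁ h =
    let G , run , exact = greedyRun cs sorted (remove-between between h) pending'
    in G , drop (uniquelyCompletable (remove-between between h)) run , exact
    where
    pending' : ∀ {a b} → hole a b ≡ true → (a , b) ∈ cs ⊎ remove P x y a b ≡ nothing
    pending' h' with pending h'
    ... | inj₁ (here refl) = inj₂ (remove-self P x y)
    ... | inj₁ (there ∈cs) = inj₁ ∈cs
    ... | inj₂ P≡          = inj₂ (remove-nothing P x y P≡)
  ... | inj₂ filled =
    let G , run , exact = greedyRun cs sorted between pending'
    in G , keep (Switch.¬uniquelyCompletable latin (intercalate k) empty) run , exact
    where
    k : CornerOf L hole x y
    k = corner x y filled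

    pending' : ∀ {a b} → hole a b ≡ true → (a , b) ∈ cs ⊎ P a b ≡ nothing
    pending' h' with pending h'
    ... | inj₁ (here refl) with () ← trans (sym filled) h'
    ... | inj₁ (there ∈cs) = inj₁ ∈cs
    ... | inj₂ P≡          = inj₂ P≡

    empty : ∀ a b → InCells (intercalate k) a b → remove P x y a b ≡ nothing
    empty a b ∈I with intercalate-cells k ∈I
    ... | inj₁ (refl , refl) = remove-self P x y
    -- The list is decreasing in reading order, so a cell later than `(x , y)` is not pending any
    -- more and must be empty.
    ... | inj₂ (h , later) with pending h
    ... | inj₁ (here refl) = contradiction later ≺-irrefl
    ... | inj₁ (there ∈cs) = contradiction (All.lookup before ∈cs) (≺-asym later)
    ... | inj₂ P≡          = remove-nothing P x y P≡

  isTwoCritical : ∀ {P} → Exact P → IsTwoCritical P L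
  isTwoCritical {P} (between , empty) = (uniquelyCompletable between , minimal) , meets
    where
    corner-at : ∀ {r c e} → P r c ≡ just e → CornerOf L hole r c
    corner-at {r} {c} P≡ with hole? r c
    ... | inj₂ filled = corner r c filled
    ... | inj₁ h with () ← trans (sym (empty h)) P≡

    meets-once : ∀ {r c} (k : CornerOf L hole r c) a b {e} → InCells (intercalate k) a b → P a b ≡ just e → a ≡ r × b ≡ c
    meets-once k a b ∈I P≡ with intercalate-cells k ∈I
    ... | inj₁ eq       = eq
    ... | inj₂ (h , _) with () ← trans (sym (empty h)) P≡

    meets : ∀ r c e → P r c ≡ just e → Σ (Intercalate L) λ I →
      InCells I r c × (∀ a b e' → InCells I a b → P a b ≡ just e' → a ≡ r × b ≡ c)
    meets r c e P≡ = intercalate k , (inj₁ refl , inj₁ refl) , λ a b _ → meets-once k a b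
      where k = corner-at P≡

    minimal : ∀ Q → Q ⊆P P → ¬ (P ⊆P Q) → ¬ UniquelyCompletable Q L
    minimal Q Q⊆P P⊈Q uc = P⊈Q P⊆Q
      where
      P⊆Q : P ⊆P Q
      P⊆Q r c e P≡ with Q r c in Q≡
      ... | just e' = trans (sym (Q⊆P r c e' Q≡)) P≡
      -- `P` meets the intercalate only in this cell. As `Q` lies in `P` and lacks it, `Q` misses
      -- the whole intercalate.
      ... | nothing = contradiction uc (Switch.¬uniquelyCompletable latin (intercalate k) avoided)
        where
        k = corner-at P≡

        avoided : ∀ a b → InCells (intercalate k) a b → Q a b ≡ nothing
        avoided a b ∈I with Q a b in Qab
        ... | nothing = refl
        ... | just e' with refl , refl ← meets-once k a b ∈I (Q⊆P a b e' Qab) with () ← trans (sym Qab) Q≡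

  gcs-properties : HasGoodGcs L
  gcs-properties
    with G , run , exact ← greedyRun (greedyOrder n) (greedyOrder-sorted n)
                             (λ _ _ → inj₁ refl) (λ _ → inj₁ (∈-greedyOrder _)) =
    G , run , isTwoCritical exact , strongCompletion (proj₁ exact) , completesTopDown (proj₁ exact)

-- Finite checks by decision procedures

abstract
  -- Abstract, so that the proof of a finite check is not unfolded where it is used.
  decided : ∀ {a} {A : Set a} (A? : Dec A) {_ : True A?} → A
  decided A? {t} = toWitness t

module Enumerated {A : Set} (elements : List A) (complete : ∀ x → x ∈ elements) where

  ∀? : ∀ {p} {P : A → Set p} → Decidable P → Dec (∀ x → P x)
  ∀? P? = map′ (λ ps x → All.lookup ps (complete x)) (λ f → All.tabulate (λ {x} _ → f x)) (All.all? P? elements)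

  ∃? : ∀ {p} {P : A → Set p} → Decidable P → Dec (∃ P)
  ∃? P? = map′ Any.satisfied (λ (x , px) → lose (complete x) px) (Any.any? P? elements)

∈-Bool : (b : Bool) → b ∈ false ∷ true ∷ []
∈-Bool false = here refl
∈-Bool true  = there (here refl)

open Enumerated (false ∷ true ∷ []) ∈-Bool using () renaming (∀? to ∀Bool?)

-- Binary representations and exclusive-or

bit : Bool → ℕ
bit false = 0
bit true  = 1

-- The lowest bit comes first.
val : Vec Bool m → ℕ
val []      = 0
val (b ∷ v) = bit b + 2 * val v

-- The lowest bits cannot reverse a strict comparison of the upper parts, since they contribute less
-- than 2.
bit+2*-mono : ∀ a b {x y} → x < y → bit a + 2 * x < bit b + 2 * y
bit+2*-mono a b {x} {y} x<y = begin-strict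
  bit a + 2 * x <⟨ +-monoˡ-< (2 * x) (bit<2 a) ⟩
  2 + 2 * x     ≡⟨ *-suc 2 x ⟨
  2 * suc x     ≤⟨ *-monoʳ-≤ 2 x<y ⟩
  2 * y         ≤⟨ m≤n+m (2 * y) (bit b) ⟩
  bit b + 2 * y ∎
  where
  open ≤-Reasoning
  bit<2 : ∀ a → bit a < 2
  bit<2 false = s≤s z≤n
  bit<2 true  = s≤s (s≤s z≤n)

val<2^ : (v : Vec Bool m) → val v < 2 ^ m
val<2^ []      = s≤s z≤n
val<2^ (b ∷ v) = bit+2*-mono b false (val<2^ v)

bit-injective : ∀ a b → bit a ≡ bit b → a ≡ b
bit-injective false false _ = refl
bit-injective true  true  _ = refl

val-injective : (v w : Vec Bool m) → val v ≡ val w → v ≡ w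
val-injective []      []      _  = refl
val-injective (a ∷ v) (b ∷ w) eq with <-cmp (val v) (val w)
... | tri< v<w _ _ = contradiction eq (<⇒≢ (bit+2*-mono a b v<w))
... | tri> _ _ w<v = contradiction eq (<⇒≢ (bit+2*-mono b a w<v) ∘ sym)
... | tri≈ _ v≡w _ with refl ← val-injective v w v≡w =
  cong (_∷ v) (bit-injective a b (+-cancelʳ-≡ (2 * val v) (bit a) (bit b) eq))

bit+2*-%2 : ∀ b x → (bit b + 2 * x) % 2 ≡ bit b
bit+2*-%2 b x = trans (cong (λ y → (bit b + y) % 2) (*-comm 2 x)) (trans ([m+kn]%n≡m%n (bit b) x 2) (bit%2 b))
  where
  bit%2 : ∀ b → bit b % 2 ≡ bit b
  bit%2 false = refl
  bit%2 true  = refl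

bit+2*-/2 : ∀ b x → (bit b + 2 * x) / 2 ≡ x
bit+2*-/2 b x = trans (cong (λ y → (bit b + y) / 2) (*-comm 2 x))
  (trans (+-distrib-/-∣ʳ (bit b) {x * 2} {2} (n∣m*n x)) (trans (cong (_+ x * 2 / 2) (bit/2 b)) (m*n/n≡m x 2)))
  where
  bit/2 : ∀ b → bit b / 2 ≡ 0
  bit/2 false = refl
  bit/2 true  = refl

infixl 6 _⊕_

_⊕_ : Vec Bool m → Vec Bool m → Vec Bool m
_⊕_ = zipWith _xor_

xorBits-val : (v w : Vec Bool m) → xorBits m (val v) (val w) ≡ val (v ⊕ w)
xorBits-val []      []      = refl
xorBits-val {suc m} (a ∷ v) (b ∷ w)
  rewrite bit+2*-%2 a (val v) | bit+2*-%2 b (val w) | bit+2*-/2 a (val v) | bit+2*-/2 b (val w) =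
  cong₂ (λ x y → x + 2 * y) (bit-xor a b) (xorBits-val v w)
  where
  bit-xor : ∀ a b → (bit a + bit b) % 2 ≡ bit (a xor b)
  bit-xor false false = refl
  bit-xor false true  = refl
  bit-xor true  false = refl
  bit-xor true  true  = refl

index : Vec Bool m → Fin (2 ^ m)
index v = fromℕ< (val<2^ v)

toℕ-index : (v : Vec Bool m) → toℕ (index v) ≡ val v
toℕ-index v = toℕ-fromℕ< (val<2^ v)

index-injective : (v w : Vec Bool m) → index v ≡ index w → v ≡ w
index-injective v w eq = val-injective v w (trans (sym (toℕ-index v)) (trans (cong toℕ eq) (toℕ-index w)))

digits : ∀ m → ℕ → Vec Bool m
digits zero    a = []
digits (suc m) a = (a % 2 ≡ᵇ 1) ∷ digits m (a / 2)

val-digits : ∀ m a → a < 2 ^ m → val (digits m a) ≡ a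
val-digits zero    zero _ = refl
val-digits zero    (suc a) (s≤s ())
val-digits (suc m) a a<  = begin
  bit (a % 2 ≡ᵇ 1) + 2 * val (digits m (a / 2))   ≡⟨ cong₂ _+_ (bit-≡ᵇ (a % 2) (m%n<n a 2))
                                                       (cong (2 *_) (val-digits m (a / 2) a/2<2^m)) ⟩
  a % 2 + 2 * (a / 2)                             ≡⟨ cong (a % 2 +_) (*-comm 2 (a / 2)) ⟩
  a % 2 + a / 2 * 2                               ≡⟨ m≡m%n+[m/n]*n a 2 ⟨
  a                                               ∎
  where
  open ≡-Reasoning
  a/2<2^m : a / 2 < 2 ^ m
  a/2<2^m = m<n*o⇒m/o<n (subst (a <_) (*-comm 2 (2 ^ m)) a<)

  bit-≡ᵇ : ∀ d → d < 2 → bit (d ≡ᵇ 1) ≡ d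
  bit-≡ᵇ 0 _ = refl
  bit-≡ᵇ 1 _ = refl
  bit-≡ᵇ (suc (suc _)) (s≤s (s≤s ()))

indexed : ∀ m (x : Fin (2 ^ m)) → Σ (Vec Bool m) λ v → index v ≡ x
indexed m x = digits m (toℕ x) ,
  toℕ-injective (trans (toℕ-index (digits m (toℕ x))) (val-digits m (toℕ x) (toℕ<n x)))

Ls-index : (v w : Vec Bool m) → Ls m (index v) (index w) ≡ index (v ⊕ w)
Ls-index {m} v w = toℕ-injective (begin
  toℕ (Ls m (index v) (index w))               ≡⟨ toℕ-fromℕ< _ ⟩
  xorBits m (toℕ (index v)) (toℕ (index w))    ≡⟨ cong₂ (xorBits m) (toℕ-index v) (toℕ-index w) ⟩
  xorBits m (val v) (val w)                    ≡⟨ xorBits-val v w ⟩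
  val (v ⊕ w)                                  ≡⟨ toℕ-index (v ⊕ w) ⟨
  toℕ (index (v ⊕ w))                          ∎)
  where open ≡-Reasoning

⊕-cancelˡ : (v w : Vec Bool m) → v ⊕ (v ⊕ w) ≡ w
⊕-cancelˡ []      []      = refl
⊕-cancelˡ (a ∷ v) (b ∷ w) = cong₂ _∷_ (decided (∀Bool? λ a → ∀Bool? λ b → (a xor (a xor b)) Bool.≟ b) a b) (⊕-cancelˡ v w)

⊕-comm : (v w : Vec Bool m) → v ⊕ w ≡ w ⊕ v
⊕-comm []      []      = refl
⊕-comm (a ∷ v) (b ∷ w) = cong₂ _∷_ (decided (∀Bool? λ a → ∀Bool? λ b → (a xor b) Bool.≟ (b xor a)) a b) (⊕-comm v w)

⊕-assoc : (u v w : Vec Bool m) → u ⊕ v ⊕ w ≡ u ⊕ (v ⊕ w)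
⊕-assoc []      []      []      = refl
⊕-assoc (a ∷ u) (b ∷ v) (c ∷ w) = cong₂ _∷_
  (decided (∀Bool? λ a → ∀Bool? λ b → ∀Bool? λ c → ((a xor b) xor c) Bool.≟ (a xor (b xor c))) a b c) (⊕-assoc u v w)

⊕-cancelʳ : (v w : Vec Bool m) → v ⊕ w ⊕ w ≡ v
⊕-cancelʳ v w = trans (⊕-comm (v ⊕ w) w) (trans (cong (w ⊕_) (⊕-comm v w)) (⊕-cancelˡ w v))

-- For `forced`: the row with label `a ⊕ c ⊕ d` has in column `c` the symbol that the row with label
-- `a` has in column `d`.
⊕-return : (a c d : Vec Bool m) → a ⊕ c ⊕ d ⊕ c ≡ a ⊕ d
⊕-return a c d = begin
  a ⊕ c ⊕ d ⊕ c    ≡⟨ cong (_⊕ c) (trans (⊕-assoc a c d) (trans (cong (a ⊕_) (⊕-comm c d)) (sym (⊕-assoc a d c)))) ⟩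
  a ⊕ d ⊕ c ⊕ c    ≡⟨ ⊕-cancelʳ (a ⊕ d) c ⟩
  a ⊕ d            ∎
  where open ≡-Reasoning

-- Turns equality on the diagonal of an intercalate into equality on its antidiagonal, by adding
-- `b ⊕ d` to both sides.
⊕-exchange : (a b c d : Vec Bool m) → a ⊕ b ≡ c ⊕ d → a ⊕ d ≡ c ⊕ b
⊕-exchange a b c d eq = begin
  a ⊕ d            ≡⟨ ⊕-return a b d ⟨
  a ⊕ b ⊕ d ⊕ b    ≡⟨ cong (λ x → x ⊕ d ⊕ b) eq ⟩
  c ⊕ d ⊕ d ⊕ b    ≡⟨ cong (_⊕ b) (⊕-cancelʳ c d) ⟩
  c ⊕ b            ∎
  where open ≡-Reasoning

⊕-fixed : (u v w : Vec Bool m) → u ⊕ v ⊕ w ≡ u → v ≡ w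
⊕-fixed u v w eq = begin
  v                ≡⟨ ⊕-cancelˡ u v ⟨
  u ⊕ (u ⊕ v)      ≡⟨ cong (u ⊕_) (⊕-cancelʳ (u ⊕ v) w) ⟨
  u ⊕ (u ⊕ v ⊕ w ⊕ w) ≡⟨ cong (λ x → u ⊕ (x ⊕ w)) eq ⟩
  u ⊕ (u ⊕ w)      ≡⟨ ⊕-cancelˡ u w ⟩
  w                ∎
  where open ≡-Reasoning

Ls-involutive : ∀ m r c → Ls m r (Ls m r c) ≡ c
Ls-involutive m r c with indexed m r | indexed m c
... | v , refl | w , refl =
  trans (cong (Ls m (index v)) (Ls-index v w)) (trans (Ls-index v (v ⊕ w)) (cong index (⊕-cancelˡ v w)))

Ls-comm : ∀ m r c → Ls m r c ≡ Ls m c r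
Ls-comm m r c with indexed m r | indexed m c
... | v , refl | w , refl = trans (Ls-index v w) (trans (cong index (⊕-comm v w)) (sym (Ls-index w v)))

Ls-latin : ∀ m → IsLatin (Ls m)
Ls-latin m = row , λ c → uniquePreimages-≗ (Ls-comm m c) (row c)
  where
  row : ∀ r → UniquePreimages (Ls m r)
  row r e = Ls m r e , Ls-involutive m r e , λ { c refl → sym (Ls-involutive m r c) }

-- Bitwise relations between the upper parts of rows and columns

Covers : Vec Bool m → Vec Bool m → Set
Covers []      []      = ⊤
Covers (a ∷ u) (b ∷ v) = T (a ∨ b) × Covers u v

covers? : (u v : Vec Bool m) → Dec (Covers u v)
covers? []      []      = yes tt
covers? (a ∷ u) (b ∷ v) = T? (a ∨ b) ×-dec covers? u v

infix 4 _⊆_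

_⊆_ : Vec Bool m → Vec Bool m → Set
[]      ⊆ []      = ⊤
(a ∷ u) ⊆ (b ∷ v) = T (not a ∨ b) × u ⊆ v

⊆⇒val≤ : (u v : Vec Bool m) → u ⊆ v → val u ≤ val v
⊆⇒val≤ []      []      _          = z≤n
⊆⇒val≤ (a ∷ u) (b ∷ v) (a≤b , u⊆v) = +-mono-≤ (bit-mono a b a≤b) (*-monoʳ-≤ 2 (⊆⇒val≤ u v u⊆v))
  where
  bit-mono : ∀ a b → T (not a ∨ b) → bit a ≤ bit b
  bit-mono false _    _ = z≤n
  bit-mono true  true _ = s≤s z≤n

⊆∧≢⇒val< : (u v : Vec Bool m) → u ⊆ v → u ≢ v → val u < val v
⊆∧≢⇒val< u v u⊆v u≢v = ≤∧≢⇒< (⊆⇒val≤ u v u⊆v) (u≢v ∘ val-injective u v)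

-- Where `u` has a zero, `v` and `w` both have a one, and these cancel.
covers-⊕-⊆ : (u v w : Vec Bool m) → Covers u v → Covers u w → u ⊕ v ⊕ w ⊆ u
covers-⊕-⊆ []      []      []      _        _        = tt
covers-⊕-⊆ (a ∷ u) (b ∷ v) (c ∷ w) (p , ps) (q , qs) =
  decided (∀Bool? λ a → ∀Bool? λ b → ∀Bool? λ c →
    T? (a ∨ b) →-dec (T? (a ∨ c) →-dec T? (not ((a xor b) xor c) ∨ a))) a b c p q , covers-⊕-⊆ u v w ps qs

infixr 7 _⊔¬_

-- The operation changes a bit only where both arguments vanish. So `u ⊔¬ v` and `v ⊔¬ u` are `u`
-- and `v` with their common zeros turned into ones; this preserves their sum and increases both
-- unless `Covers u v`. They are the opposite corner of an intercalate.
_⊔¬_ : Vec Bool m → Vec Bool m → Vec Bool m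
_⊔¬_ = zipWith (λ a b → a ∨ not b)

⊆-⊔¬ : (u v : Vec Bool m) → u ⊆ u ⊔¬ v
⊆-⊔¬ []      []      = tt
⊆-⊔¬ (a ∷ u) (b ∷ v) = decided (∀Bool? λ a → ∀Bool? λ b → T? (not a ∨ (a ∨ not b))) a b , ⊆-⊔¬ u v

covers-⊔¬ˡ : (u v : Vec Bool m) → Covers (u ⊔¬ v) v
covers-⊔¬ˡ []      []      = tt
covers-⊔¬ˡ (a ∷ u) (b ∷ v) = decided (∀Bool? λ a → ∀Bool? λ b → T? ((a ∨ not b) ∨ b)) a b , covers-⊔¬ˡ u v

covers-⊔¬ʳ : (u v : Vec Bool m) → Covers u (v ⊔¬ u)
covers-⊔¬ʳ []      []      = tt
covers-⊔¬ʳ (a ∷ u) (b ∷ v) = decided (∀Bool? λ a → ∀Bool? λ b → T? (a ∨ (b ∨ not a))) a b , covers-⊔¬ʳ u v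

covers-⊔¬ : (u v : Vec Bool m) → Covers (u ⊔¬ v) (v ⊔¬ u)
covers-⊔¬ []      []      = tt
covers-⊔¬ (a ∷ u) (b ∷ v) = decided (∀Bool? λ a → ∀Bool? λ b → T? ((a ∨ not b) ∨ (b ∨ not a))) a b , covers-⊔¬ u v

⊔¬-⊕ : (u v : Vec Bool m) → u ⊕ v ≡ u ⊔¬ v ⊕ v ⊔¬ u
⊔¬-⊕ []      []      = refl
⊔¬-⊕ (a ∷ u) (b ∷ v) =
  cong₂ _∷_ (decided (∀Bool? λ a → ∀Bool? λ b → (a xor b) Bool.≟ ((a ∨ not b) xor (b ∨ not a))) a b) (⊔¬-⊕ u v)

⊔¬-increasesˡ : (u v : Vec Bool m) → ¬ Covers u v → val u < val (u ⊔¬ v)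
⊔¬-increasesˡ u v ¬cov = ⊆∧≢⇒val< u (u ⊔¬ v) (⊆-⊔¬ u v) λ eq → ¬cov (subst (λ x → Covers x v) (sym eq) (covers-⊔¬ˡ u v))

⊔¬-increasesʳ : (u v : Vec Bool m) → ¬ Covers u v → val v < val (v ⊔¬ u)
⊔¬-increasesʳ u v ¬cov = ⊆∧≢⇒val< v (v ⊔¬ u) (⊆-⊔¬ v u) λ eq → ¬cov (subst (Covers u) (sym eq) (covers-⊔¬ʳ u v))

-- u ⊆ q, and v agrees with the complement of q outside u; equivalently u ⊔¬ v ≡ q.
Shadow : Vec Bool m → Vec Bool m → Vec Bool m → Set
Shadow []      []      []      = ⊤
Shadow (p ∷ q) (a ∷ u) (b ∷ v) = T (if a then p else p xor b) × Shadow q u v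

shadow? : (q u v : Vec Bool m) → Dec (Shadow q u v)
shadow? []      []      []      = yes tt
shadow? (p ∷ q) (a ∷ u) (b ∷ v) = T? (if a then p else p xor b) ×-dec shadow? q u v

shadow⇒⊆ : (q u v : Vec Bool m) → Shadow q u v → u ⊆ q
shadow⇒⊆ []      []      []      _        = tt
shadow⇒⊆ (p ∷ q) (a ∷ u) (b ∷ v) (s , ss) =
  decided (∀Bool? λ p → ∀Bool? λ a → ∀Bool? λ b → T? (if a then p else p xor b) →-dec T? (not a ∨ p)) p a b s ,
  shadow⇒⊆ q u v ss

shadow⇒≡ : (q u v : Vec Bool m) → Shadow q u v → u ⊔¬ v ≡ q
shadow⇒≡ []      []      []      _        = refl
shadow⇒≡ (p ∷ q) (a ∷ u) (b ∷ v) (s , ss) = cong₂ _∷_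
  (decided (∀Bool? λ p → ∀Bool? λ a → ∀Bool? λ b → T? (if a then p else p xor b) →-dec ((a ∨ not b) Bool.≟ p)) p a b s)
  (shadow⇒≡ q u v ss)

shadow-⊔¬ : (u v : Vec Bool m) → Shadow (u ⊔¬ v) u v
shadow-⊔¬ []      []      = tt
shadow-⊔¬ (a ∷ u) (b ∷ v) =
  decided (∀Bool? λ a → ∀Bool? λ b → T? (if a then a ∨ not b else (a ∨ not b) xor b)) a b , shadow-⊔¬ u v

-- Outside `u`, both `v` and `w` agree with the complement of `q`, so they cancel.
shadow-⊕-⊆ : (q u v w : Vec Bool m) → Shadow q u v → Shadow q u w → u ⊕ v ⊕ w ⊆ u
shadow-⊕-⊆ []      []      []      []      _        _        = tt
shadow-⊕-⊆ (p ∷ q) (a ∷ u) (b ∷ v) (c ∷ w) (s , ss) (t , ts) =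
  decided (∀Bool? λ p → ∀Bool? λ a → ∀Bool? λ b → ∀Bool? λ c →
    T? (if a then p else p xor b) →-dec (T? (if a then p else p xor c) →-dec
    T? (not ((a xor b) xor c) ∨ a))) p a b c s t ,
  shadow-⊕-⊆ q u v w ss ts

covers-mono : (u q v : Vec Bool m) → u ⊆ q → Covers u v → Covers q v
covers-mono []      []      []      _        _        = tt
covers-mono (a ∷ u) (p ∷ q) (b ∷ v) (s , ss) (t , ts) =
  decided (∀Bool? λ a → ∀Bool? λ p → ∀Bool? λ b → T? (not a ∨ p) →-dec (T? (a ∨ b) →-dec T? (p ∨ b))) a p b s t ,
  covers-mono u q v ss ts

-- v vanishes at the lowest zero bit of q.
LowestGap : Vec Bool m → Vec Bool m → Set
LowestGap []          []      = ⊥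
LowestGap (false ∷ q) (b ∷ v) = T (not b)
LowestGap (true ∷ q)  (b ∷ v) = LowestGap q v

lowestGap? : (q v : Vec Bool m) → Dec (LowestGap q v)
lowestGap? []          []      = no λ ()
lowestGap? (false ∷ q) (b ∷ v) = T? (not b)
lowestGap? (true ∷ q)  (b ∷ v) = lowestGap? q v

lowestGap⇒¬covers : (q v : Vec Bool m) → LowestGap q v → ¬ Covers q v
lowestGap⇒¬covers []          []          ()  _
lowestGap⇒¬covers (false ∷ q) (false ∷ v) _   (() , _)
lowestGap⇒¬covers (true ∷ q)  (b ∷ v)     gap (_ , cov) = lowestGap⇒¬covers q v gap cov

-- At the lowest zero bit of `q` all of `q`, `v` and `w` vanish, hence so does their sum. This
-- excludes a blocking cell of kind `S` for two holes of kind `Z′`.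
lowestGap-⊕⇒¬covers : (q v w : Vec Bool m) → LowestGap q v → LowestGap q w → ¬ Covers (q ⊕ v ⊕ w) v
lowestGap-⊕⇒¬covers []          []          []          ()
lowestGap-⊕⇒¬covers (false ∷ q) (false ∷ v) (false ∷ w) _ _ (() , _)
lowestGap-⊕⇒¬covers (true ∷ q)  (b ∷ v)     (c ∷ w)     g h (_ , cov) = lowestGap-⊕⇒¬covers q v w g h cov

-- openGap q v is v ⊔¬ q with the lowest zero bit of q cleared.  It still exceeds v when v has this bit and
-- ¬ Covers q v, because then a higher bit has been added.  closeGap q v is the matching row q ⊕ v ⊕ openGap q v.
openGap : Vec Bool m → Vec Bool m → Vec Bool m
openGap []          []      = []
openGap (false ∷ q) (_ ∷ v) = false ∷ v ⊔¬ q
openGap (true ∷ q)  (b ∷ v) = b ∷ openGap q v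

closeGap : Vec Bool m → Vec Bool m → Vec Bool m
closeGap []          []      = []
closeGap (false ∷ q) (_ ∷ v) = true ∷ q ⊔¬ v
closeGap (true ∷ q)  (_ ∷ v) = true ∷ closeGap q v

openGap-gap : (q v : Vec Bool m) → ¬ Covers q v → LowestGap q (openGap q v)
openGap-gap []          []      ¬cov = ¬cov tt
openGap-gap (false ∷ q) (b ∷ v) _    = tt
openGap-gap (true ∷ q)  (b ∷ v) ¬cov = openGap-gap q v (¬cov ∘ (tt ,_))

openGap-increases : (q v : Vec Bool m) → ¬ Covers q v → ¬ LowestGap q v → val v < val (openGap q v)
openGap-increases []          []          ¬cov _    = contradiction tt ¬cov
openGap-increases (false ∷ q) (false ∷ v) _    ¬gap = contradiction tt ¬gap
openGap-increases (false ∷ q) (true ∷ v)  ¬cov _    = bit+2*-mono true false (⊔¬-increasesʳ q v (¬cov ∘ (tt ,_)))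
openGap-increases (true ∷ q)  (b ∷ v)     ¬cov ¬gap = bit+2*-mono b b (openGap-increases q v (¬cov ∘ (tt ,_)) ¬gap)

closeGap-increases : (q v : Vec Bool m) → ¬ Covers q v → ¬ LowestGap q v → val q < val (closeGap q v)
closeGap-increases []          []          ¬cov _    = contradiction tt ¬cov
closeGap-increases (false ∷ q) (false ∷ v) _    ¬gap = contradiction tt ¬gap
closeGap-increases (false ∷ q) (true ∷ v)  ¬cov _    = bit+2*-mono false true (⊔¬-increasesˡ q v (¬cov ∘ (tt ,_)))
closeGap-increases (true ∷ q)  (b ∷ v)     ¬cov ¬gap = bit+2*-mono true true (closeGap-increases q v (¬cov ∘ (tt ,_)) ¬gap)

-- At the lowest zero bit of `q` the one of `v` moves from the column to the row; at the higher bits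
-- common zeros become ones on both sides.
openGap-⊕ : (q v : Vec Bool m) → ¬ LowestGap q v → q ⊕ v ≡ closeGap q v ⊕ openGap q v
openGap-⊕ []          []          _    = refl
openGap-⊕ (false ∷ q) (false ∷ v) ¬gap = contradiction tt ¬gap
openGap-⊕ (false ∷ q) (true ∷ v)  _    = cong (true ∷_) (⊔¬-⊕ q v)
openGap-⊕ (true ∷ q)  (b ∷ v)     ¬gap = cong (not b ∷_) (openGap-⊕ q v ¬gap)

covers-closeGap : (q v : Vec Bool m) → Covers (closeGap q v) v
covers-closeGap []          []      = tt
covers-closeGap (false ∷ q) (_ ∷ v) = tt , covers-⊔¬ˡ q v
covers-closeGap (true ∷ q)  (_ ∷ v) = tt , covers-closeGap q v

covers-closeGap-openGap : (q v : Vec Bool m) → Covers (closeGap q v) (openGap q v)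
covers-closeGap-openGap []          []      = tt
covers-closeGap-openGap (false ∷ q) (_ ∷ v) = tt , covers-⊔¬ q v
covers-closeGap-openGap (true ∷ q)  (_ ∷ v) = tt , covers-closeGap-openGap q v

-- The number of common ones; it is the dominant part of the rank of a hole.
weight : Vec Bool m → Vec Bool m → ℕ
weight []      []      = 0
weight (a ∷ u) (b ∷ v) = bit (a ∧ b) + weight u v

-- Where `u` has a one and `v` a zero, covering forces a zero of `w`. So every common one of `u` and
-- `w` is one of `u` and `v`.
covers-⊕⇒weight≤ : (u v w : Vec Bool m) → Covers (u ⊕ v ⊕ w) v → weight u w ≤ weight u v
covers-⊕⇒weight≤ []      []      []      _        = z≤n
covers-⊕⇒weight≤ (a ∷ u) (b ∷ v) (c ∷ w) (p , ps) = +-mono-≤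
  (decided (∀Bool? λ a → ∀Bool? λ b → ∀Bool? λ c →
    T? (((a xor b) xor c) ∨ b) →-dec (bit (a ∧ c) ≤? bit (a ∧ b))) a b c p)
  (covers-⊕⇒weight≤ u v w ps)

-- Along cells of these two types, a cell which is not forced at once has a larger weight than the one blocking it:
-- the order of filling is by weight.
Contrary : Vec Bool m → Vec Bool m → Vec Bool m → Vec Bool m → Set
Contrary q u v w = (Covers u v × Shadow q u w) ⊎ (Shadow q u v × Covers u w)

-- No bit contributes more to the left side than to the right, and a bit where `u ⊕ v ⊕ w` differs
-- from `q` contributes strictly less: there `u` and `v` have a one and `w` a zero.
contrary-weight< : (q u v w : Vec Bool m) → Contrary q u v w → Covers (u ⊕ v ⊕ w) v → u ⊕ v ⊕ w ≢ q →
  weight u w < weight u v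
contrary-weight< []      []      []      []      _        _        ≢ = contradiction refl ≢
contrary-weight< (p ∷ q) (a ∷ u) (b ∷ v) (c ∷ w) contrary (k , ks) ≢
  with ((a xor b) xor c) Bool.≟ p
... | yes eq = +-mono-≤-<
  (decided (∀Bool? λ a → ∀Bool? λ b → ∀Bool? λ c →
    T? (((a xor b) xor c) ∨ b) →-dec (bit (a ∧ c) ≤? bit (a ∧ b))) a b c k)
  (contrary-weight< q u v w (tails contrary) ks (≢ ∘ cong₂ _∷_ eq))
  where
  tails : Contrary (p ∷ q) (a ∷ u) (b ∷ v) (c ∷ w) → Contrary q u v w
  tails (inj₁ ((_ , x) , _ , y)) = inj₁ (x , y)
  tails (inj₂ ((_ , x) , _ , y)) = inj₂ (x , y)
... | no neq = +-mono-<-≤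
  (decided (∀Bool? λ p → ∀Bool? λ a → ∀Bool? λ b → ∀Bool? λ c →
    ((T? (a ∨ b) ×-dec T? (if a then p else p xor c)) ⊎-dec (T? (if a then p else p xor b) ×-dec T? (a ∨ c)))
     →-dec (T? (((a xor b) xor c) ∨ b) →-dec (¬? (((a xor b) xor c) Bool.≟ p) →-dec
     (bit (a ∧ c) <? bit (a ∧ b))))) p a b c (heads contrary) k neq)
  (covers-⊕⇒weight≤ u v w ks)
  where
  heads : Contrary (p ∷ q) (a ∷ u) (b ∷ v) (c ∷ w) →
    (T (a ∨ b) × T (if a then p else p xor c)) ⊎ (T (if a then p else p xor b) × T (a ∨ c))
  heads (inj₁ ((x , _) , y , _)) = inj₁ (x , y)
  heads (inj₂ ((x , _) , y , _)) = inj₂ (x , y)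

-- Kinds of cells, upper parts of corners and of blocking cells

-- The relation of the upper parts u, v of a cell to q.  Unprimed kinds have u ≢ q: Covers u v for S, where the holes
-- are those of gcs(L_s), Shadow q u v for D, and O for the rest, which has no holes.  Primed kinds have u ≡ q:
-- Covers q v for S′, LowestGap q v for Z′, and O′ for the rest.
data Kind : Set where
  S D O S′ Z′ O′ : Kind

-- For two holes (u , v), (u , w) of a row, of kinds K, K', the symbol of the second is excluded from the first one by
-- the cell (u ⊕ v ⊕ w , v), of kind K₂, provided that this is not a hole.  In the cases Free it never is one; in the
-- cases Tie it is one only if the second hole has the smaller lowRank.
data Free : Kind → Kind → Kind → Set where
  O**  : ∀ {K' K₂} → Free O K' K₂
  *O*  : ∀ {K K₂} → Free K O K₂
  **O  : ∀ {K K'} → Free K K' O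
  SDD  : Free S D D
  DSD  : Free D S D

data Tie : Kind → Kind → Kind → Set where
  SDS′  : Tie S D S′
  DSS′  : Tie D S S′
  S′Z′S : Tie S′ Z′ S
  Z′S′S : Tie Z′ S′ S
  S′O′S : Tie S′ O′ S
  O′S′S : Tie O′ S′ S
  Z′O′S : Tie Z′ O′ S
  O′Z′S : Tie O′ Z′ S
  O′O′S : Tie O′ O′ S

module Block (q : Vec Bool m) where

  data Outer (u v : Vec Bool m) : Kind → Set where
    s : Covers u v → Outer u v S
    d : Shadow q u v → Outer u v D
    o : ¬ Covers u v → ¬ Shadow q u v → Outer u v O

  data Inner (v : Vec Bool m) : Kind → Set where
    s′ : Covers q v → Inner v S′
    z′ : LowestGap q v → Inner v Z′
    o′ : ¬ Covers q v → ¬ LowestGap q v → Inner v O′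

  data View (u v : Vec Bool m) : Kind → Set where
    outer : ∀ {K} → u ≢ q → Outer u v K → View u v K
    inner : ∀ {K} → u ≡ q → Inner v K → View u v K

  -- If `u` covers `v`, there are no common zeros and `u ⊔¬ v` is `u`; but a shadow makes it `q`.
  shadow⇒¬covers : ∀ {u v} → u ≢ q → Shadow q u v → ¬ Covers u v
  shadow⇒¬covers {u} {v} u≢q sh cov = u≢q (val-injective u q (≤-antisym
    (⊆⇒val≤ u q (shadow⇒⊆ q u v sh))
    (subst (_≤ val u) (cong val (shadow⇒≡ q u v sh)) (⊆⇒val≤ (u ⊔¬ v) u (covers⇒⊆ u v cov)))))
    where
    covers⇒⊆ : ∀ {m} (u v : Vec Bool m) → Covers u v → u ⊔¬ v ⊆ u
    covers⇒⊆ []      []      _        = tt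
    covers⇒⊆ (a ∷ u) (b ∷ v) (p , ps) =
      decided (∀Bool? λ a → ∀Bool? λ b → T? (a ∨ b) →-dec T? (not (a ∨ not b) ∨ a)) a b p , covers⇒⊆ u v ps

  abstract
    -- Abstract: later arguments know `kind` only through `view`, and `view-unique` identifies it.
    classify : ∀ u v → ∃ (View u v)
    classify u v with Vec.≡-dec Bool._≟_ u q
    classify u v | yes u≡q with covers? q v | lowestGap? q v
    ... | yes cov | _       = S′ , inner u≡q (s′ cov)
    ... | no _    | yes gap = Z′ , inner u≡q (z′ gap)
    ... | no ¬cov | no ¬gap = O′ , inner u≡q (o′ ¬cov ¬gap)
    classify u v | no u≢q with covers? u v | shadow? q u v
    ... | yes cov | _       = S , outer u≢q (s cov)
    ... | no _    | yes sh  = D , outer u≢q (d sh)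
    ... | no ¬cov | no ¬sh  = O , outer u≢q (o ¬cov ¬sh)

    kind : Vec Bool m → Vec Bool m → Kind
    kind u v = proj₁ (classify u v)

    view : ∀ u v → View u v (kind u v)
    view u v = proj₂ (classify u v)

  outer-unique : ∀ {u v K K'} → u ≢ q → Outer u v K → Outer u v K' → K ≡ K'
  outer-unique _   (s _)    (s _)    = refl
  outer-unique u≢q (s c)    (d h)    = contradiction c (shadow⇒¬covers u≢q h)
  outer-unique _   (s c)    (o ¬c _) = contradiction c ¬c
  outer-unique u≢q (d h)    (s c)    = contradiction c (shadow⇒¬covers u≢q h)
  outer-unique _   (d _)    (d _)    = refl
  outer-unique _   (d h)    (o _ ¬h) = contradiction h ¬h
  outer-unique _   (o ¬c _) (s c)    = contradiction c ¬c
  outer-unique _   (o _ ¬h) (d h)    = contradiction h ¬h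
  outer-unique _   (o _ _)  (o _ _)  = refl

  inner-unique : ∀ {v K K'} → Inner v K → Inner v K' → K ≡ K'
  inner-unique (s′ _)    (s′ _)    = refl
  inner-unique (s′ c)    (z′ g)    = contradiction c (lowestGap⇒¬covers q _ g)
  inner-unique (s′ c)    (o′ ¬c _) = contradiction c ¬c
  inner-unique (z′ g)    (s′ c)    = contradiction c (lowestGap⇒¬covers q _ g)
  inner-unique (z′ _)    (z′ _)    = refl
  inner-unique (z′ g)    (o′ _ ¬g) = contradiction g ¬g
  inner-unique (o′ ¬c _) (s′ c)    = contradiction c ¬c
  inner-unique (o′ _ ¬g) (z′ g)    = contradiction g ¬g
  inner-unique (o′ _ _)  (o′ _ _)  = refl

  view-unique : ∀ {u v K K'} → View u v K → View u v K' → K ≡ K'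
  view-unique (outer u≢q V) (outer _ V')  = outer-unique u≢q V V'
  view-unique (inner _ V)   (inner _ V')  = inner-unique V V'
  view-unique (outer u≢q _) (inner u≡q _) = contradiction u≡q u≢q
  view-unique (inner u≡q _) (outer u≢q _) = contradiction u≡q u≢q

  kind≡ : ∀ {u v K} → View u v K → kind u v ≡ K
  kind≡ = view-unique (view _ _)

  -- Both upper parts increase strictly, so the two lowest bits of the opposite corner can be chosen
  -- without regard to order.
  record UpperCorner (u v : Vec Bool m) (K₁ K₂ K₃ : Kind) : Set where
    constructor mkUpperCorner
    field
      u' v'  : Vec Bool m
      u<u'   : val u < val u'
      v<v'   : val v < val v'
      ⊕-eq   : u ⊕ v ≡ u' ⊕ v'
      view₁  : View u v' K₁
      view₂  : View u' v K₂
      view₃  : View u' v' K₃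

  -- Since `(u , v)` is not a shadow, the new row part `u ⊔¬ v` differs from `q`, and all three
  -- cells have kind `S`.
  cornerO : ∀ {u v} → u ≢ q → ¬ Covers u v → ¬ Shadow q u v → UpperCorner u v S S S
  cornerO {u} {v} u≢q ¬cov ¬sh = mkUpperCorner (u ⊔¬ v) (v ⊔¬ u)
    (⊔¬-increasesˡ u v ¬cov) (⊔¬-increasesʳ u v ¬cov) (⊔¬-⊕ u v)
    (outer u≢q (s (covers-⊔¬ʳ u v))) (outer ≢q (s (covers-⊔¬ˡ u v))) (outer ≢q (s (covers-⊔¬ u v)))
    where
    ≢q : u ⊔¬ v ≢ q
    ≢q eq = ¬sh (subst (λ x → Shadow x u v) eq (shadow-⊔¬ u v))

  -- Here the new row part is exactly `q`, so the lower two cells lie in the block of the swapped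
  -- rows.
  cornerD : ∀ {u v} → u ≢ q → Shadow q u v → UpperCorner u v S S′ S′
  cornerD {u} {v} u≢q sh = mkUpperCorner (u ⊔¬ v) (v ⊔¬ u)
    (⊔¬-increasesˡ u v ¬cov) (⊔¬-increasesʳ u v ¬cov) (⊔¬-⊕ u v)
    (outer u≢q (s (covers-⊔¬ʳ u v))) (inner ≡q (s′ (subst (λ x → Covers x v) ≡q (covers-⊔¬ˡ u v))))
    (inner ≡q (s′ (subst (λ x → Covers x (v ⊔¬ u)) ≡q (covers-⊔¬ u v))))
    where
    ¬cov : ¬ Covers u v
    ¬cov = shadow⇒¬covers u≢q sh
    ≡q : u ⊔¬ v ≡ q
    ≡q = shadow⇒≡ q u v sh

  cornerS′ : ∀ {v} → ¬ Covers q v → UpperCorner q v S′ S S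
  cornerS′ {v} ¬cov = mkUpperCorner (q ⊔¬ v) (v ⊔¬ q)
    q< (⊔¬-increasesʳ q v ¬cov) (⊔¬-⊕ q v)
    (inner refl (s′ (covers-⊔¬ʳ q v))) (outer ≢q (s (covers-⊔¬ˡ q v))) (outer ≢q (s (covers-⊔¬ q v)))
    where
    q< : val q < val (q ⊔¬ v)
    q< = ⊔¬-increasesˡ q v ¬cov
    ≢q : q ⊔¬ v ≢ q
    ≢q eq = <-irrefl (cong val (sym eq)) q<

  cornerZ′ : ∀ {v} → ¬ Covers q v → ¬ LowestGap q v → UpperCorner q v Z′ S S
  cornerZ′ {v} ¬cov ¬gap = mkUpperCorner (closeGap q v) (openGap q v)
    q< (openGap-increases q v ¬cov ¬gap) (openGap-⊕ q v ¬gap)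
    (inner refl (z′ (openGap-gap q v ¬cov))) (outer ≢q (s (covers-closeGap q v)))
    (outer ≢q (s (covers-closeGap-openGap q v)))
    where
    q< : val q < val (closeGap q v)
    q< = closeGap-increases q v ¬cov ¬gap
    ≢q : closeGap q v ≢ q
    ≢q eq = <-irrefl (cong val (sym eq)) q<

  -- The ways in which the blocking cell `(u ⊕ v ⊕ w , v)` is dealt with. With `same` it lies in the
  -- block of `u` itself, and the two lowest bits decide; `less` contradicts the order of the ranks;
  -- `tie` passes the comparison on to `lowRank`.
  data UpperForced (u v w : Vec Bool m) (K K' K₂ : Kind) : Set where
    same  : v ≡ w → UpperForced u v w K K' K₂
    above : val (u ⊕ v ⊕ w) < val u → UpperForced u v w K K' K₂
    less  : weight u w < weight u v → UpperForced u v w K K' K₂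
    free  : Free K K' K₂ → UpperForced u v w K K' K₂
    tie   : weight u w ≤ weight u v → Tie K K' K₂ → UpperForced u v w K K' K₂

  module _ {u v w : Vec Bool m} where

    forced-⊆ : ∀ {K K' K₂} → u ⊕ v ⊕ w ⊆ u → UpperForced u v w K K' K₂
    forced-⊆ ⊆u with m≤n⇒m<n∨m≡n (⊆⇒val≤ (u ⊕ v ⊕ w) u ⊆u)
    ... | inj₁ <u = above <u
    ... | inj₂ ≡u = same (⊕-fixed u v w (val-injective _ u ≡u))

    forced-tie : ∀ {K K' K₂} → Covers (u ⊕ v ⊕ w) v → Tie K K' K₂ → UpperForced u v w K K' K₂
    forced-tie cov = tie (covers-⊕⇒weight≤ u v w cov)

    -- Split on the kind of the blocking cell. Kind `S` occurs only away from `q`, where the weight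
    -- drops strictly; kinds `Z′` and `O′` are impossible because `q` covers `v`.
    forced-contrary : ∀ {K K' K₂} → Contrary q u v w → Covers q v → View (u ⊕ v ⊕ w) v K₂ →
      Free K K' D → Tie K K' S′ → UpperForced u v w K K' K₂
    forced-contrary c _  (outer ≢q (s cov))       _ _ = less (contrary-weight< q u v w c cov ≢q)
    forced-contrary _ _  (outer _ (d _))          f _ = free f
    forced-contrary _ _  (outer _ (o _ _))        _ _ = free **O
    forced-contrary _ _  (inner ≡q (s′ cov))      _ t = forced-tie (subst (λ x → Covers x v) (sym ≡q) cov) t
    forced-contrary _ qv (inner _ (z′ gap))       _ _ = contradiction qv (lowestGap⇒¬covers q v gap)
    forced-contrary _ qv (inner _ (o′ ¬cov _))    _ _ = contradiction qv ¬cov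

  covers-q : ∀ {u v w} → Shadow q u w → Covers u v → Covers q v
  covers-q {u} {v} {w} sh cov = covers-mono u q v (shadow⇒⊆ q u w sh) cov

  shadow⇒covers-q : ∀ {u v} → Shadow q u v → Covers q v
  shadow⇒covers-q {u} {v} sh = subst (λ x → Covers x v) (shadow⇒≡ q u v sh) (covers-⊔¬ˡ u v)

  forced-outer : ∀ {u v w K K' K₂} → Outer u v K → Outer u w K' → View (u ⊕ v ⊕ w) v K₂ → UpperForced u v w K K' K₂
  forced-outer (o _ _) _        _ = free O**
  forced-outer (s _)   (o _ _)  _ = free *O*
  forced-outer (d _)   (o _ _)  _ = free *O*
  forced-outer (s c)   (s c')   _ = forced-⊆ (covers-⊕-⊆ _ _ _ c c')
  forced-outer (d h)   (d h')   _ = forced-⊆ (shadow-⊕-⊆ q _ _ _ h h')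
  forced-outer (s c)   (d h)    V = forced-contrary (inj₁ (c , h)) (covers-q h c) V SDD SDS′
  forced-outer (d h)   (s c)    V = forced-contrary (inj₂ (h , c)) (shadow⇒covers-q h) V DSD DSS′

  -- If the blocking row part exceeds `q`, it is not `q`, and it has no shadow cell, since the row
  -- part of a shadow is contained in `q`. Only kinds `S` and `O` remain.
  forced-q : ∀ {v w K K' K₂} → (Covers (q ⊕ v ⊕ w) v → Tie K K' S) →
    View (q ⊕ v ⊕ w) v K₂ → UpperForced q v w K K' K₂
  forced-q {v} {w} t V with <-cmp (val (q ⊕ v ⊕ w)) (val q)
  ... | tri< <q _ _ = above <q
  ... | tri≈ _ ≡q _ = same (⊕-fixed q v w (val-injective _ q ≡q))
  forced-q t (outer _ (s cov))        | tri> _ _ _  = forced-tie cov (t cov)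
  forced-q t (outer _ (d sh))         | tri> _ _ >q = contradiction (⊆⇒val≤ _ q (shadow⇒⊆ q _ _ sh)) (<⇒≱ >q)
  forced-q t (outer _ (o _ _))        | tri> _ _ _  = free **O
  forced-q t (inner ≡q _)             | tri> _ _ >q = contradiction (cong val (sym ≡q)) (<⇒≢ >q)

  forced-inner : ∀ {v w K K' K₂} → Inner v K → Inner w K' → View (q ⊕ v ⊕ w) v K₂ → UpperForced q v w K K' K₂
  forced-inner (s′ c)   (s′ c')  _ = forced-⊆ (covers-⊕-⊆ q _ _ c c')
  forced-inner (s′ _)   (z′ _)   = forced-q λ _ → S′Z′S
  forced-inner (s′ _)   (o′ _ _) = forced-q λ _ → S′O′S
  forced-inner (z′ _)   (s′ _)   = forced-q λ _ → Z′S′S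
  forced-inner (z′ g)   (z′ g')  = forced-q λ cov → contradiction cov (lowestGap-⊕⇒¬covers q _ _ g g')
  forced-inner (z′ _)   (o′ _ _) = forced-q λ _ → Z′O′S
  forced-inner (o′ _ _) (s′ _)   = forced-q λ _ → O′S′S
  forced-inner (o′ _ _) (z′ _)   = forced-q λ _ → O′Z′S
  forced-inner (o′ _ _) (o′ _ _) = forced-q λ _ → O′O′S

  upperForced : ∀ {u v w K K' K₂} → View u v K → View u w K' → View (u ⊕ v ⊕ w) v K₂ → UpperForced u v w K K' K₂
  upperForced (outer _ V)    (outer _ V')  = forced-outer V V'
  upperForced (inner refl V) (inner _ V')  = forced-inner V V'
  upperForced (outer u≢q _)  (inner u≡q _) = contradiction u≡q u≢q
  upperForced (inner u≡q _)  (outer u≢q _) = contradiction u≡q u≢q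

-- Finite checks on the two lowest bits

Low : Set
Low = Bool × Bool

pattern 𝟎 = false , false
pattern 𝟏 = true , false
pattern 𝟐 = false , true
pattern 𝟑 = true , true

infixl 6 _⊻_

_⊻_ : Low → Low → Low
(a , b) ⊻ (c , d) = a xor c , b xor d

lowVal : Low → ℕ
lowVal (a , b) = bit a + 2 * bit b

infix 4 _≟ᴸ_

_≟ᴸ_ : (ρ σ : Low) → Dec (ρ ≡ σ)
_≟ᴸ_ = Product.≡-dec Bool._≟_ Bool._≟_

-- The pairs of rows at distance less than three in a block of four; only the pair 0, 3 is excluded.
data Swap : Set where
  s01 s02 s12 s13 s23 : Swap

∈-Low : (ρ : Low) → ρ ∈ 𝟎 ∷ 𝟏 ∷ 𝟐 ∷ 𝟑 ∷ []
∈-Low 𝟎 = here refl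
∈-Low 𝟏 = there (here refl)
∈-Low 𝟐 = there (there (here refl))
∈-Low 𝟑 = there (there (there (here refl)))

open Enumerated (𝟎 ∷ 𝟏 ∷ 𝟐 ∷ 𝟑 ∷ []) ∈-Low using () renaming (∀? to ∀Low?; ∃? to ∃Low?)

∈-Swap : (w : Swap) → w ∈ s01 ∷ s02 ∷ s12 ∷ s13 ∷ s23 ∷ []
∈-Swap s01 = here refl
∈-Swap s02 = there (here refl)
∈-Swap s12 = there (there (here refl))
∈-Swap s13 = there (there (there (here refl)))
∈-Swap s23 = there (there (there (there (here refl))))

open Enumerated (s01 ∷ s02 ∷ s12 ∷ s13 ∷ s23 ∷ []) ∈-Swap using () renaming (∀? to ∀Swap?; ∃? to ∃Swap?)

left right : Swap → Low
left s01 = 𝟎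
left s02 = 𝟎
left s12 = 𝟏
left s13 = 𝟏
left s23 = 𝟐
right s01 = 𝟏
right s02 = 𝟐
right s12 = 𝟐
right s13 = 𝟑
right s23 = 𝟑

swapLow : Swap → Low → Low
swapLow w ρ with ρ ≟ᴸ left w | ρ ≟ᴸ right w
... | yes _ | _     = right w
... | no _  | yes _ = left w
... | no _  | no _  = ρ

-- The primed kinds are those in the block of the swapped rows, so the kind shows whether the label
-- changes.
relabel : Swap → Kind → Low → Low
relabel _ S  ρ = ρ
relabel _ D  ρ = ρ
relabel _ O  ρ = ρ
relabel w S′ ρ = swapLow w ρ
relabel w Z′ ρ = swapLow w ρ
relabel w O′ ρ = swapLow w ρ

-- Found by running the greedy algorithm for small s.
lowHole : Swap → Kind → Low → Low → Bool
lowHole _   S  (a , b) (c , d) = (a ∨ c) ∧ (b ∨ d)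
lowHole s01 D  𝟎 𝟐 = true
lowHole s02 D  𝟎 𝟐 = true
lowHole s13 D  𝟎 𝟏 = true
lowHole s13 D  𝟏 𝟎 = true
lowHole s13 D  𝟏 𝟏 = true
lowHole s23 D  𝟎 𝟎 = true
lowHole s23 D  𝟐 𝟎 = true
lowHole s23 D  𝟐 𝟐 = true
lowHole _   S′ 𝟑 _ = true
lowHole _   S′ _ 𝟑 = true
lowHole s01 S′ 𝟎 𝟎 = true
lowHole s01 S′ 𝟏 𝟐 = true
lowHole s01 S′ 𝟐 𝟏 = true
lowHole s23 S′ 𝟎 𝟎 = true
lowHole s23 S′ 𝟏 𝟐 = true
lowHole s23 S′ 𝟐 𝟏 = true
lowHole s02 S′ 𝟎 𝟏 = true
lowHole s02 S′ 𝟏 𝟎 = true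
lowHole s02 S′ 𝟐 𝟐 = true
lowHole s13 S′ 𝟎 𝟏 = true
lowHole s13 S′ 𝟏 𝟎 = true
lowHole s13 S′ 𝟐 𝟐 = true
lowHole s12 S′ 𝟏 𝟏 = true
lowHole s12 S′ 𝟐 𝟐 = true
lowHole s01 Z′ 𝟎 𝟎 = true
lowHole s02 Z′ 𝟏 𝟎 = true
lowHole s13 Z′ 𝟏 𝟏 = true
lowHole s13 Z′ 𝟏 𝟐 = true
lowHole s13 Z′ 𝟐 𝟎 = true
lowHole s13 Z′ 𝟐 𝟏 = true
lowHole s23 Z′ 𝟐 𝟎 = true
lowHole s23 Z′ 𝟐 𝟐 = true
lowHole s01 O′ 𝟎 𝟎 = true
lowHole s02 O′ 𝟏 𝟎 = true
lowHole _   _  _ _ = false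

-- Breaks ties between equal weights. Any values at most 3 that pass the checks `lowSame` and
-- `lowTie` would serve.
lowRank : Swap → Kind → Low → ℕ
lowRank _   S  𝟑 = 3
lowRank _   S  _ = 1
lowRank s13 D  𝟎 = 2
lowRank s23 D  𝟐 = 2
lowRank _   S′ 𝟎 = 0
lowRank _   S′ 𝟑 = 3
lowRank _   S′ _ = 2
lowRank _   Z′ _ = 1
lowRank _   O′ _ = 1
lowRank _   _  _ = 0

LowCorner : Swap → Kind → Kind → Kind → Kind → Low → Low → Low → Low → Set
LowCorner w K K₁ K₂ K₃ ρ σ ρ' σ' =
  relabel w K ρ ⊻ σ ≡ relabel w K₂ ρ' ⊻ σ' ×
  lowHole w K₁ ρ σ' ≡ true × lowHole w K₂ ρ' σ ≡ true × lowHole w K₃ ρ' σ' ≡ true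

lowCorner? : ∀ w K K₁ K₂ K₃ ρ σ ρ' σ' → Dec (LowCorner w K K₁ K₂ K₃ ρ σ ρ' σ')
lowCorner? w K K₁ K₂ K₃ ρ σ ρ' σ' =
  (_ ≟ᴸ _) ×-dec ((_ Bool.≟ _) ×-dec ((_ Bool.≟ _) ×-dec (_ Bool.≟ _)))

MovedCorner : Swap → Kind → Kind → Kind → Kind → Low → Low → Set
MovedCorner w K K₁ K₂ K₃ ρ σ = ∃ λ ρ' → ∃ λ σ' → LowCorner w K K₁ K₂ K₃ ρ σ ρ' σ'

movedCorner? : ∀ w K K₁ K₂ K₃ ρ σ → Dec (MovedCorner w K K₁ K₂ K₃ ρ σ)
movedCorner? w K K₁ K₂ K₃ ρ σ = ∃Low? λ ρ' → ∃Low? λ σ' → lowCorner? w K K₁ K₂ K₃ ρ σ ρ' σ'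

-- For kinds `S` and `S′` the intercalate keeps the upper parts, so the lowest bits alone must
-- increase.
SameCorner : Swap → Kind → Low → Low → Set
SameCorner w K ρ σ = ∃ λ ρ' → ∃ λ σ' →
  lowVal ρ < lowVal ρ' × lowVal σ < lowVal σ' × LowCorner w K K K K ρ σ ρ' σ'

sameCorner? : ∀ w K ρ σ → Dec (SameCorner w K ρ σ)
sameCorner? w K ρ σ = ∃Low? λ ρ' → ∃Low? λ σ' →
  (_ <? _) ×-dec ((_ <? _) ×-dec lowCorner? w K K K K ρ σ ρ' σ')

lowCornerS : ∀ w ρ σ → lowHole w S ρ σ ≡ false → SameCorner w S ρ σ
lowCornerS = decided (∀Swap? λ w → ∀Low? λ ρ → ∀Low? λ σ → (_ Bool.≟ _) →-dec sameCorner? w S ρ σ)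

lowCornerS′ : ∀ w ρ σ → lowHole w S′ ρ σ ≡ false → SameCorner w S′ ρ σ
lowCornerS′ = decided (∀Swap? λ w → ∀Low? λ ρ → ∀Low? λ σ → (_ Bool.≟ _) →-dec sameCorner? w S′ ρ σ)

lowCornerO : ∀ w ρ σ → MovedCorner w O S S S ρ σ
lowCornerO = decided (∀Swap? λ w → ∀Low? λ ρ → ∀Low? λ σ → movedCorner? w O S S S ρ σ)

lowCornerD : ∀ w ρ σ → lowHole w D ρ σ ≡ false → MovedCorner w D S S′ S′ ρ σ
lowCornerD = decided (∀Swap? λ w → ∀Low? λ ρ → ∀Low? λ σ → (_ Bool.≟ _) →-dec movedCorner? w D S S′ S′ ρ σ)

lowCornerZ′ : ∀ w ρ σ → lowHole w Z′ ρ σ ≡ false → MovedCorner w Z′ S′ S S ρ σ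
lowCornerZ′ = decided (∀Swap? λ w → ∀Low? λ ρ → ∀Low? λ σ → (_ Bool.≟ _) →-dec movedCorner? w Z′ S′ S S ρ σ)

lowCornerO′ : ∀ w ρ σ → lowHole w O′ ρ σ ≡ false → MovedCorner w O′ S′ S S ρ σ ⊎ MovedCorner w O′ Z′ S S ρ σ
lowCornerO′ = decided (∀Swap? λ w → ∀Low? λ ρ → ∀Low? λ σ →
  (_ Bool.≟ _) →-dec (movedCorner? w O′ S′ S S ρ σ ⊎-dec movedCorner? w O′ Z′ S S ρ σ))

-- The outer `relabel` turns the label of the blocking row back into its position, the swap being an
-- involution.
LowSame : Kind → Set
LowSame K = ∀ w ρ σ σ' → σ ≢ σ' → lowHole w K ρ σ ≡ true → lowHole w K ρ σ' ≡ true →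
  lowRank w K σ ≤ lowRank w K σ' →
  let ρ' = relabel w K (relabel w K ρ ⊻ σ ⊻ σ') in lowVal ρ' < lowVal ρ ⊎ lowHole w K ρ' σ ≡ false

lowSame? : ∀ K → Dec (LowSame K)
lowSame? K = ∀Swap? λ w → ∀Low? λ ρ → ∀Low? λ σ → ∀Low? λ σ' →
  ¬? (σ ≟ᴸ σ') →-dec ((_ Bool.≟ _) →-dec ((_ Bool.≟ _) →-dec ((_ ≤? _) →-dec ((_ <? _) ⊎-dec (_ Bool.≟ _)))))

lowSame : ∀ K → LowSame K
lowSame S  = decided (lowSame? S)
lowSame D  = decided (lowSame? D)
lowSame O  = decided (lowSame? O)
lowSame S′ = decided (lowSame? S′)
lowSame Z′ = decided (lowSame? Z′)
lowSame O′ = decided (lowSame? O′)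

LowFilled : (K K' K₂ : Kind) → Set
LowFilled K K' K₂ = ∀ w ρ σ σ' → lowHole w K ρ σ ≡ true → lowHole w K' ρ σ' ≡ true →
  lowRank w K σ ≤ lowRank w K' σ' → lowHole w K₂ (relabel w K₂ (relabel w K ρ ⊻ σ ⊻ σ')) σ ≡ false

lowFilled? : ∀ K K' K₂ → Dec (LowFilled K K' K₂)
lowFilled? K K' K₂ = ∀Swap? λ w → ∀Low? λ ρ → ∀Low? λ σ → ∀Low? λ σ' →
  (_ Bool.≟ _) →-dec ((_ Bool.≟ _) →-dec ((_ ≤? _) →-dec (_ Bool.≟ _)))

lowTie : ∀ {K K' K₂} → Tie K K' K₂ → LowFilled K K' K₂
lowTie SDS′  = decided (lowFilled? S D S′)
lowTie DSS′  = decided (lowFilled? D S S′)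
lowTie S′Z′S = decided (lowFilled? S′ Z′ S)
lowTie Z′S′S = decided (lowFilled? Z′ S′ S)
lowTie S′O′S = decided (lowFilled? S′ O′ S)
lowTie O′S′S = decided (lowFilled? O′ S′ S)
lowTie Z′O′S = decided (lowFilled? Z′ O′ S)
lowTie O′Z′S = decided (lowFilled? O′ Z′ S)
lowTie O′O′S = decided (lowFilled? O′ O′ S)

LowFree : (K K' K₂ : Kind) → Set
LowFree K K' K₂ = ∀ w ρ σ σ' → lowHole w K ρ σ ≡ true → lowHole w K' ρ σ' ≡ true →
  lowHole w K₂ (relabel w K₂ (relabel w K ρ ⊻ σ ⊻ σ')) σ ≡ false

lowFree? : ∀ K K' K₂ → Dec (LowFree K K' K₂)
lowFree? K K' K₂ = ∀Swap? λ w → ∀Low? λ ρ → ∀Low? λ σ → ∀Low? λ σ' →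
  (_ Bool.≟ _) →-dec ((_ Bool.≟ _) →-dec (_ Bool.≟ _))

lowFree : ∀ {K K' K₂} → Free K K' K₂ → LowFree K K' K₂
lowFree O** _ _ _ _ ()
lowFree *O* _ _ _ _ _ ()
lowFree **O _ _ _ _ _ _ = refl
lowFree SDD = decided (lowFree? S D D)
lowFree DSD = decided (lowFree? D S D)

lowRank≤3 : ∀ w K σ → lowRank w K σ ≤ 3
lowRank≤3 w S  σ = decided (∀Swap? λ w → ∀Low? λ σ → lowRank w S σ ≤? 3) w σ
lowRank≤3 w D  σ = decided (∀Swap? λ w → ∀Low? λ σ → lowRank w D σ ≤? 3) w σ
lowRank≤3 w O  σ = decided (∀Swap? λ w → ∀Low? λ σ → lowRank w O σ ≤? 3) w σ
lowRank≤3 w S′ σ = decided (∀Swap? λ w → ∀Low? λ σ → lowRank w S′ σ ≤? 3) w σ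
lowRank≤3 w Z′ σ = decided (∀Swap? λ w → ∀Low? λ σ → lowRank w Z′ σ ≤? 3) w σ
lowRank≤3 w O′ σ = decided (∀Swap? λ w → ∀Low? λ σ → lowRank w O′ σ ≤? 3) w σ

swapLow-involutive : ∀ w ρ → swapLow w (swapLow w ρ) ≡ ρ
swapLow-involutive = decided (∀Swap? λ w → ∀Low? λ ρ → _ ≟ᴸ _)

swap-between : ∀ ρ ρ' → lowVal ρ < lowVal ρ' → lowVal ρ' ∸ lowVal ρ < 3 → ∃ λ w → left w ≡ ρ × right w ≡ ρ'
swap-between = decided (∀Low? λ ρ → ∀Low? λ ρ' → (_ <? _) →-dec ((_ <? _) →-dec
  ∃Swap? λ w → (left w ≟ᴸ ρ) ×-dec (right w ≟ᴸ ρ')))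

lowVal<4 : ∀ ρ → lowVal ρ < 4
lowVal<4 = decided (∀Low? λ ρ → _ <? 4)

-- Joining lowest bits and upper parts

join : Low → Vec Bool m → Vec Bool (2 + m)
join (a , b) u = a ∷ b ∷ u

val-join : (ρ : Low) (u : Vec Bool m) → val (join ρ u) ≡ lowVal ρ + 4 * val u
val-join (a , b) u = begin
  bit a + 2 * (bit b + 2 * val u)           ≡⟨ cong (bit a +_) (*-distribˡ-+ 2 (bit b) (2 * val u)) ⟩
  bit a + (2 * bit b + 2 * (2 * val u))     ≡⟨ +-assoc (bit a) (2 * bit b) (2 * (2 * val u)) ⟨
  bit a + 2 * bit b + 2 * (2 * val u)       ≡⟨ cong (bit a + 2 * bit b +_) (*-assoc 2 2 (val u)) ⟨
  bit a + 2 * bit b + 4 * val u             ∎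
  where open ≡-Reasoning

join-upper< : (ρ ρ' : Low) (u u' : Vec Bool m) → val u < val u' → val (join ρ u) < val (join ρ' u')
join-upper< (a , b) (a' , b') _ _ u<u' = bit+2*-mono a a' (bit+2*-mono b b' u<u')

join-lower< : (ρ ρ' : Low) (u : Vec Bool m) → lowVal ρ < lowVal ρ' → val (join ρ u) < val (join ρ' u)
join-lower< ρ ρ' u ρ<ρ' = subst₂ _<_ (sym (val-join ρ u)) (sym (val-join ρ' u)) (+-monoˡ-< (4 * val u) ρ<ρ')

Cell : ℕ → Set
Cell m = Low × Vec Bool m

joined : Cell m → Vec Bool (2 + m)
joined (ρ , u) = join ρ u

code : Cell m → Fin (2 ^ (2 + m))
code x = index (joined x)

abstract
  split : ∀ m → Fin (2 ^ (2 + m)) → Cell m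
  split m x = let v = proj₁ (indexed (2 + m) x) in (head v , head (tail v)) , tail (tail v)

  code-split : ∀ m x → code (split m x) ≡ x
  code-split m x = proj₂ (indexed (2 + m) x)

code-injective : (x y : Cell m) → code x ≡ code y → x ≡ y
code-injective (ρ , u) (σ , v) eq with refl ← index-injective (join ρ u) (join σ v) eq = refl

split-code : (x : Cell m) → split m (code x) ≡ x
split-code {m} x = code-injective (split m (code x)) x (code-split m (code x))

-- The hole set of the square with two rows interchanged

module Swapped {m} (w : Swap) (q : Vec Bool m) where
  open Block q

  k k' : Fin (2 ^ (2 + m))
  k  = code (left w , q)
  k' = code (right w , q)

  L : Square (2 ^ (2 + m))
  L = permuteRows (swapFin k k') (Ls (2 + m))

  -- Depends on the upper part of the row alone, because a row label must not refer to a column as a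
  -- kind does; `relabelRow-view` reconciles the two.
  relabelRow : Vec Bool m → Low → Low
  relabelRow u ρ with Vec.≡-dec Bool._≟_ u q
  ... | yes _ = swapLow w ρ
  ... | no _  = ρ

  relabelRow-involutive : ∀ u ρ → relabelRow u (relabelRow u ρ) ≡ ρ
  relabelRow-involutive u ρ with Vec.≡-dec Bool._≟_ u q
  ... | yes _ = swapLow-involutive w ρ
  ... | no _  = refl

  relabelRow-view : ∀ {u v K} → View u v K → ∀ ρ → relabelRow u ρ ≡ relabel w K ρ
  relabelRow-view {u} V ρ with Vec.≡-dec Bool._≟_ u q
  relabelRow-view (outer u≢q _)        ρ | yes u≡q = contradiction u≡q u≢q
  relabelRow-view (inner _ (s′ _))     ρ | yes _   = refl
  relabelRow-view (inner _ (z′ _))     ρ | yes _   = refl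
  relabelRow-view (inner _ (o′ _ _))   ρ | yes _   = refl
  relabelRow-view (outer _ (s _))      ρ | no _    = refl
  relabelRow-view (outer _ (d _))      ρ | no _    = refl
  relabelRow-view (outer _ (o _ _))    ρ | no _    = refl
  relabelRow-view (inner u≡q _)        ρ | no u≢q  = contradiction u≡q u≢q

  swapFin-code : ∀ ρ u → swapFin k k' (code (ρ , u)) ≡ code (relabelRow u ρ , u)
  swapFin-code ρ u with Vec.≡-dec Bool._≟_ u q
  ... | no u≢q = swapFin-fixed k k' λ
    { (inj₁ eq) → u≢q (cong proj₂ (code-injective (ρ , u) (left w , q) eq))
    ; (inj₂ eq) → u≢q (cong proj₂ (code-injective (ρ , u) (right w , q) eq)) }
  ... | yes refl with ρ ≟ᴸ left w | ρ ≟ᴸ right w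
  ...   | yes refl | _        = swapFin-left k k'
  ...   | no _     | yes refl = swapFin-right k k'
  ...   | no ≢l    | no ≢r    = swapFin-fixed k k' λ
    { (inj₁ eq) → ≢l (cong proj₁ (code-injective (ρ , q) (left w , q) eq))
    ; (inj₂ eq) → ≢r (cong proj₁ (code-injective (ρ , q) (right w , q) eq)) }

  label : Cell m → Vec Bool (2 + m)
  label (ρ , u) = join (relabelRow u ρ) u

  L-code : ∀ x y → L (code x) (code y) ≡ index (label x ⊕ joined y)
  L-code x y = trans (cong (λ r → Ls (2 + m) r (code y)) (swapFin-code (proj₁ x) (proj₂ x))) (Ls-index (label x) (joined y))

  cellHole : Cell m → Cell m → Bool
  cellHole (ρ , u) (σ , v) = lowHole w (kind u v) ρ σ

  -- The factor 4 exceeds every value of `lowRank`, so the order is lexicographic with the weight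
  -- first.
  cellRank : Cell m → Cell m → ℕ
  cellRank (ρ , u) (σ , v) = 4 * weight u v + lowRank w (kind u v) σ

  hole : Fin (2 ^ (2 + m)) → Fin (2 ^ (2 + m)) → Bool
  hole r c = cellHole (split m r) (split m c)

  rank : Fin (2 ^ (2 + m)) → Fin (2 ^ (2 + m)) → ℕ
  rank r c = cellRank (split m r) (split m c)

  hole-code : ∀ x y → hole (code x) (code y) ≡ cellHole x y
  hole-code x y = cong₂ cellHole (split-code x) (split-code y)

  code-mono : (x y : Cell m) → val (joined x) < val (joined y) → toℕ (code x) < toℕ (code y)
  code-mono x y = subst₂ _<_ (sym (toℕ-index (joined x))) (sym (toℕ-index (joined y)))

  mkCorner : ∀ x y x' y' → val (joined x) < val (joined x') → val (joined y) < val (joined y') →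
    label x ⊕ joined y ≡ label x' ⊕ joined y' →
    cellHole x y' ≡ true → cellHole x' y ≡ true → cellHole x' y' ≡ true → CornerOf L hole (code x) (code y)
  mkCorner x y x' y' x<x' y<y' eq h₁ h₂ h₃ = record
    { r<r' = code-mono x x' x<x'
    ; c<c' = code-mono y y' y<y'
    ; diagonal = trans (L-code x y) (trans (cong index eq) (sym (L-code x' y')))
    ; antidiag = trans (L-code x y')
        (trans (cong index (⊕-exchange (label x) (joined y) (label x') (joined y') eq)) (sym (L-code x' y)))
    ; hole-rc' = trans (hole-code x y') h₁
    ; hole-r'c = trans (hole-code x' y) h₂
    ; hole-r'c' = trans (hole-code x' y') h₃
    }

  cellHole-view : ∀ {u v K ρ σ b} → View u v K → lowHole w K ρ σ ≡ b → cellHole (ρ , u) (σ , v) ≡ b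
  cellHole-view {ρ = ρ} {σ} V h = trans (cong (λ K → lowHole w K ρ σ) (kind≡ V)) h

  movedCorner : ∀ {u v K K₁ K₂ K₃} ρ σ → View u v K → UpperCorner u v K₁ K₂ K₃ →
    MovedCorner w K K₁ K₂ K₃ ρ σ → CornerOf L hole (code (ρ , u)) (code (σ , v))
  movedCorner {u} {v} ρ σ V (mkUpperCorner u' v' u<u' v<v' eq V₁ V₂ V₃) (ρ' , σ' , low , h₁ , h₂ , h₃) =
    mkCorner (ρ , u) (σ , v) (ρ' , u') (σ' , v') (join-upper< ρ ρ' u u' u<u') (join-upper< σ σ' v v' v<v')
      (cong₂ join (trans (cong (_⊻ σ) (relabelRow-view V ρ))
        (trans low (cong (_⊻ σ') (sym (relabelRow-view V₂ ρ'))))) eq)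
      (cellHole-view V₁ h₁) (cellHole-view V₂ h₂) (cellHole-view V₃ h₃)

  sameCorner : ∀ {u v K} ρ σ → View u v K → SameCorner w K ρ σ → CornerOf L hole (code (ρ , u)) (code (σ , v))
  sameCorner {u} {v} ρ σ V (ρ' , σ' , ρ<ρ' , σ<σ' , low , h₁ , h₂ , h₃) =
    mkCorner (ρ , u) (σ , v) (ρ' , u) (σ' , v) (join-lower< ρ ρ' u ρ<ρ') (join-lower< σ σ' v σ<σ')
      (cong (λ ρ → join ρ (u ⊕ v)) (trans (cong (_⊻ σ) (relabelRow-view V ρ))
        (trans low (cong (_⊻ σ') (sym (relabelRow-view V ρ'))))))
      (cellHole-view V h₁) (cellHole-view V h₂) (cellHole-view V h₃)

  cellCorner : ∀ {u v K} → View u v K → ∀ ρ σ → lowHole w K ρ σ ≡ false → CornerOf L hole (code (ρ , u)) (code (σ , v))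
  cellCorner V@(outer _ (s _))           ρ σ h = sameCorner ρ σ V (lowCornerS w ρ σ h)
  cellCorner V@(outer u≢q (d sh))        ρ σ h = movedCorner ρ σ V (cornerD u≢q sh) (lowCornerD w ρ σ h)
  cellCorner V@(outer u≢q (o ¬cov ¬sh))  ρ σ h = movedCorner ρ σ V (cornerO u≢q ¬cov ¬sh) (lowCornerO w ρ σ)
  cellCorner V@(inner refl (s′ _))       ρ σ h = sameCorner ρ σ V (lowCornerS′ w ρ σ h)
  cellCorner V@(inner refl (z′ gap))     ρ σ h =
    movedCorner ρ σ V (cornerS′ (lowestGap⇒¬covers q _ gap)) (lowCornerZ′ w ρ σ h)
  cellCorner V@(inner refl (o′ ¬cov ¬gap)) ρ σ h =
    [ movedCorner ρ σ V (cornerS′ ¬cov) , movedCorner ρ σ V (cornerZ′ ¬cov ¬gap) ]′ (lowCornerO′ w ρ σ h)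

  corner : ∀ r c → hole r c ≡ false → CornerOf L hole r c
  corner r c h = subst₂ (CornerOf L hole) (code-split m r) (code-split m c)
    (cellCorner (view (proj₂ x) (proj₂ y)) (proj₁ x) (proj₁ y) h)
    where
    x y : Cell m
    x = split m r
    y = split m c

  lowRank≤ : ∀ {a b x y} → 4 * a + x ≤ 4 * b + y → b ≤ a → x ≤ y
  lowRank≤ {a} {b} {x} {y} le b≤a = +-cancelˡ-≤ (4 * a) x y (≤-trans le (+-monoˡ-≤ y (*-monoʳ-≤ 4 b≤a)))

  weight≤ : ∀ {a b x y} → 4 * a + x ≤ 4 * b + y → y ≤ 3 → a ≤ b
  weight≤ {a} {b} {x} {y} le y≤3 = m<1+n⇒m≤n (*-cancelˡ-< 4 a (suc b) (begin-strict
    4 * a       ≤⟨ m≤m+n (4 * a) x ⟩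
    4 * a + x   ≤⟨ le ⟩
    4 * b + y   <⟨ +-monoʳ-< (4 * b) (s≤s y≤3) ⟩
    4 * b + 4   ≡⟨ +-comm (4 * b) 4 ⟩
    4 + 4 * b   ≡⟨ *-suc 4 b ⟨
    4 * suc b   ∎))
    where open ≤-Reasoning

  cellForced : ∀ ρ u σ v σ' v' → (σ , v) ≢ (σ' , v') →
    cellHole (ρ , u) (σ , v) ≡ true → cellHole (ρ , u) (σ' , v') ≡ true →
    cellRank (ρ , u) (σ , v) ≤ cellRank (ρ , u) (σ' , v') →
    let u' = u ⊕ v ⊕ v' ; ρ' = relabelRow u' (relabelRow u ρ ⊻ σ ⊻ σ') in
    val (join ρ' u') < val (join ρ u) ⊎ cellHole (ρ' , u') (σ , v) ≡ false
  cellForced ρ u σ v σ' v' ≢ h h' ≤rank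
    with upperForced (view u v) (view u v') (view (u ⊕ v ⊕ v') v)
  ... | above <u = inj₁ (join-upper< (relabelRow (u ⊕ v ⊕ v') (relabelRow u ρ ⊻ σ ⊻ σ')) ρ (u ⊕ v ⊕ v') u <u)
  ... | less <wt = contradiction <wt (≤⇒≯ (weight≤ ≤rank (lowRank≤3 w (kind u v') σ')))
  ... | free f
    rewrite relabelRow-view (view u v) ρ
          | relabelRow-view (view (u ⊕ v ⊕ v') v) (relabel w (kind u v) ρ ⊻ σ ⊻ σ') =
    inj₂ (lowFree f w ρ σ σ' h h')
  ... | tie wt≤ t
    rewrite relabelRow-view (view u v) ρ
          | relabelRow-view (view (u ⊕ v ⊕ v') v) (relabel w (kind u v) ρ ⊻ σ ⊻ σ') =
    inj₂ (lowTie t w ρ σ σ' h h' (lowRank≤ {weight u v} {weight u v'} ≤rank wt≤))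
  ... | same refl
    rewrite ⊕-cancelʳ u v | relabelRow-view (view u v) ρ
          | relabelRow-view (view u v) (relabel w (kind u v) ρ ⊻ σ ⊻ σ')
    with lowSame (kind u v) w ρ σ σ' (λ { refl → ≢ refl }) h h' (+-cancelˡ-≤ (4 * weight u v) _ _ ≤rank)
  ...   | inj₁ <ρ = inj₁ (join-lower< (relabel w (kind u v) (relabel w (kind u v) ρ ⊻ σ ⊻ σ')) ρ u <ρ)
  ...   | inj₂ h₂ = inj₂ h₂

  forced : ∀ r c c' → c ≢ c' → hole r c ≡ true → hole r c' ≡ true → rank r c ≤ rank r c' →
    Σ (Fin (2 ^ (2 + m))) λ r' → L r' c ≡ L r c' × (toℕ r' < toℕ r ⊎ hole r' c ≡ false)
  forced r c c' c≢c' h h' ≤rank = code x' , symbol , outcome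
    where
    x y y' x' : Cell m
    x = split m r
    y = split m c
    y' = split m c'
    -- The row whose label is `label x ⊕ joined y ⊕ joined y'`; the outer `relabelRow` undoes the
    -- one in `label`.
    x' = let u' = proj₂ x ⊕ proj₂ y ⊕ proj₂ y'
         in relabelRow u' (relabelRow (proj₂ x) (proj₁ x) ⊻ proj₁ y ⊻ proj₁ y') , u'

    label-x' : label x' ≡ label x ⊕ joined y ⊕ joined y'
    label-x' = cong (λ ρ → join ρ (proj₂ x')) (relabelRow-involutive (proj₂ x') _)

    symbol : L (code x') c ≡ L r c'
    symbol = begin
      L (code x') c                                ≡⟨ cong (L (code x')) (code-split m c) ⟨
      L (code x') (code y)                         ≡⟨ L-code x' y ⟩
      index (label x' ⊕ joined y)                  ≡⟨ cong (λ l → index (l ⊕ joined y)) label-x' ⟩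
      index (label x ⊕ joined y ⊕ joined y' ⊕ joined y) ≡⟨ cong index (⊕-return (label x) (joined y) (joined y')) ⟩
      index (label x ⊕ joined y')                  ≡⟨ L-code x y' ⟨
      L (code x) (code y')                         ≡⟨ cong₂ L (code-split m r) (code-split m c') ⟩
      L r c'                                       ∎
      where open ≡-Reasoning

    y≢y' : y ≢ y'
    y≢y' eq = c≢c' (trans (sym (code-split m c)) (trans (cong code eq) (code-split m c')))

    outcome : toℕ (code x') < toℕ r ⊎ hole (code x') c ≡ false
    outcome with cellForced (proj₁ x) (proj₂ x) (proj₁ y) (proj₂ y) (proj₁ y') (proj₂ y') y≢y' h h' ≤rank
    ... | inj₁ <x = inj₁ (subst (λ r → toℕ (code x') < toℕ r) (code-split m r) (code-mono x' x <x))
    ... | inj₂ h₂ = inj₂ (trans (cong (λ x → cellHole x y) (split-code x')) h₂)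

  hasGoodGcs : HasGoodGcs L
  hasGoodGcs = HoleSet.gcs-properties L (permuteRows-swap-latin k k' (Ls-latin (2 + m))) hole rank corner forced

-- Locating the swapped rows in a block of four

-- Writing `j` as `4 * i`, the bounds give `i ≤ x`, `x ≤ y` and `y ≤ i` after division by 4.
same-block : ∀ {j a b x y} → 4 ∣ j → a < 4 → j ≤ a + 4 * x → a + 4 * x < b + 4 * y → b < 4 → b + 4 * y < j + 4 → x ≡ y
same-block {a = a} {b} {x} {y} (divides i refl) a<4 j≤ <y b<4 <j+4 = ≤-antisym x≤y (≤-trans y≤i i≤x)
  where
  open ≤-Reasoning
  i≤x : i ≤ x
  i≤x = m<1+n⇒m≤n (*-cancelˡ-< 4 i (suc x) (begin-strict
    4 * i      ≡⟨ *-comm 4 i ⟩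
    i * 4      ≤⟨ j≤ ⟩
    a + 4 * x  <⟨ +-monoˡ-< (4 * x) a<4 ⟩
    4 + 4 * x  ≡⟨ *-suc 4 x ⟨
    4 * suc x  ∎))
  y≤i : y ≤ i
  y≤i = m<1+n⇒m≤n (*-cancelˡ-< 4 y (suc i) (begin-strict
    4 * y      ≤⟨ m≤n+m (4 * y) b ⟩
    b + 4 * y  <⟨ <j+4 ⟩
    i * 4 + 4  ≡⟨ trans (+-comm (i * 4) 4) (*-comm (suc i) 4) ⟩
    4 * suc i  ∎))
  x≤y : x ≤ y
  x≤y = m<1+n⇒m≤n (*-cancelˡ-< 4 x (suc y) (begin-strict
    4 * x      ≤⟨ m≤n+m (4 * x) a ⟩
    a + 4 * x  <⟨ <y ⟩
    b + 4 * y  <⟨ +-monoˡ-< (4 * y) b<4 ⟩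
    4 + 4 * y  ≡⟨ *-suc 4 y ⟨
    4 * suc y  ∎))

+-∸-cancelʳ : ∀ x y z → x + z ∸ (y + z) ≡ x ∸ y
+-∸-cancelʳ x y z = trans (cong₂ _∸_ (+-comm x z) (+-comm y z)) ([m+n]∸[m+o]≡n∸o z x y)

swap-in-block : ∀ {j} (x x' : Cell m) → 4 ∣ j → j ≤ val (joined x) → val (joined x) < val (joined x') →
  val (joined x') < j + 4 → val (joined x') ∸ val (joined x) < 3 →
  Σ Swap λ w → Σ (Vec Bool m) λ q → (left w , q) ≡ x × (right w , q) ≡ x'
swap-in-block (ρ , u) (ρ' , u') 4∣j j≤ <x' <j+4 <3
  rewrite val-join ρ u | val-join ρ' u'
  with refl ← val-injective u u' (same-block {b = lowVal ρ'} 4∣j (lowVal<4 ρ) j≤ <x' (lowVal<4 ρ') <j+4)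
  with w , refl , refl ← swap-between ρ ρ' (+-cancelʳ-< (4 * val u) (lowVal ρ) (lowVal ρ') <x')
         (subst (_< 3) (+-∸-cancelʳ (lowVal ρ') (lowVal ρ) (4 * val u)) <3) =
  w , u , refl , refl

theorem5p1 : (s : ℕ) → 2 ≤ s → (k k' : Fin (2 ^ s)) →
    toℕ k' ∸ toℕ k < 3 → toℕ k ∸ toℕ k' < 3 →
    (Σ ℕ λ j → 4 ∣ j × j ≤ toℕ k × toℕ k < toℕ k' × toℕ k' < j + 4) →
    Σ (Partial (2 ^ s)) λ G →
    IsGcs (permuteRows (swapFin k k') (Ls s)) G ×
    IsTwoCritical G (permuteRows (swapFin k k') (Ls s)) ×
    HasStrongCompletion G (permuteRows (swapFin k k') (Ls s)) ×
    CompletesTopDown G (permuteRows (swapFin k k') (Ls s))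
theorem5p1 (suc zero) (s≤s ())
theorem5p1 (suc (suc m)) _ k k' k'∸k<3 _ (j , 4∣j , j≤k , k<k' , k'<j+4) =
  let w , q , left≡ , right≡ = swap-in-block (split m k) (split m k') 4∣j
        (subst (j ≤_) toℕ-k j≤k) (subst₂ _<_ toℕ-k toℕ-k' k<k') (subst (_< j + 4) toℕ-k' k'<j+4)
        (subst₂ (λ a b → b ∸ a < 3) toℕ-k toℕ-k' k'∸k<3)
  in subst₂ (λ k k' → HasGoodGcs (permuteRows (swapFin k k') (Ls (2 + m))))
       (trans (cong code left≡) (code-split m k)) (trans (cong code right≡) (code-split m k'))
       (Swapped.hasGoodGcs w q)
  where
  toℕ-split : ∀ x → toℕ x ≡ val (joined (split m x))
  toℕ-split x = trans (cong toℕ (sym (code-split m x))) (toℕ-index (joined (split m x)))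

  toℕ-k : toℕ k ≡ val (joined (split m k))
  toℕ-k = toℕ-split k

  toℕ-k' : toℕ k' ≡ val (joined (split m k'))
  toℕ-k' = toℕ-split k'
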